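{- Let $T$ be a finite tree with $m$ edges and let $x,y\in V(T)$. Then $$d(x,y)^2 \le H_{xy} \le d(x,y)\,(2m-d(x,y)).$$ The lower bound holds with equality if and only if for every vertex $w\in V(T)$, either $w$ lies on the path from $x$ to $y$ or $y$ lies on the path from $w$ to $x$. The upper bound holds with equality if and only if for every vertex $w\in V(T)$, either $w$ lies on the path from $x$ to $y$ or $x$ lies on the path from $w$ to $y$.
   Context: The simple random walk moves at each step to a uniformly random neighbour; $H_{xy}$ is the expected number of steps for the walk started at $x$ to first reach $y$ ($H_{xx}=0$). $d(x,y)$ is the graph distance. -}

module Defs where

open import Data.Bool using (Bool; true; false; if_then_else_; _∧_; not)
open import Data.Nat as ℕ using (ℕ; zero; suc)
open import Data.Fin using (Fin; toℕ; _≟_)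
open import Data.List using (List; []; _∷_; length; map; concatMap; allFin)
open import Data.Nat.ListAction using (sum)
open import Data.List.Membership.Propositional using (_∈_)
open import Data.List.Relation.Unary.Unique.Propositional using (Unique)
open import Data.Product using (Σ; ∃; _×_)
open import Data.Integer using (+_)
open import Data.Rational as ℚ using (ℚ; 0ℚ; 1ℚ)
open import Relation.Nullary using (¬_; does)
open import Relation.Binary.PropositionalEquality using (_≡_)

record Graph (n : ℕ) : Set where
  field
    adj   : Fin n → Fin n → Bool
    sym   : ∀ i j → adj i j ≡ adj j i
    irrefl : ∀ i → adj i i ≡ false
open Graph public

module _ {n : ℕ} (G : Graph n) where

  data IsWalk : Fin n → Fin n → List (Fin n) → Set where
    single : ∀ x → IsWalk x x (x ∷ [])
    step   : ∀ {x z y p} → adj G x z ≡ true → IsWalk z y p → IsWalk x y (x ∷ p)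

  IsPath : Fin n → Fin n → List (Fin n) → Set
  IsPath x y p = IsWalk x y p × Unique p

  Connected : Set
  Connected = ∀ x y → ∃ λ p → IsWalk x y p

  HasCycle : Set
  HasCycle = Σ (Fin n) λ x → Σ (Fin n) λ z → Σ (List (Fin n)) λ p →
               IsPath x z p × (3 ℕ.≤ length p) × (adj G z x ≡ true)

  IsTree : Set
  IsTree = Connected × ¬ HasCycle

  edges : ℕ
  edges = sum (map (λ i → sum (map (λ j → if adj G i j ∧ (toℕ i ℕ.<ᵇ toℕ j) then 1 else 0)
                                   (allFin n))) (allFin n))

  deg : Fin n → ℕ
  deg v = sum (map (λ j → if adj G v j then 1 else 0) (allFin n))

  IsDist : Fin n → Fin n → ℕ → Set
  IsDist x y d = (∃ λ p → IsWalk x y p × length p ≡ suc d)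
               × (∀ p → IsWalk x y p → suc d ℕ.≤ length p)

  OnPath : Fin n → Fin n → Fin n → Set
  OnPath w x y = ∃ λ p → IsPath x y p × w ∈ p

  -- 1/deg v (deg v = 0 only for isolated vertices, from which no step is taken)
  invDeg : Fin n → ℚ
  invDeg v with deg v
  ... | zero  = 0ℚ
  ... | suc k = (+ 1) ℚ./ suc k

  allSeqs : ℕ → List (List (Fin n))
  allSeqs zero    = [] ∷ []
  allSeqs (suc k) = concatMap (λ v → map (v ∷_) (allSeqs k)) (allFin n)

  isWalkB : List (Fin n) → Bool
  isWalkB []           = true
  isWalkB (a ∷ [])     = true
  isWalkB (a ∷ b ∷ l)  = adj G a b ∧ isWalkB (b ∷ l)

  -- probability that the simple random walk started at v0 follows v0 … vk
  weight : List (Fin n) → ℚ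
  weight []          = 1ℚ
  weight (a ∷ [])    = 1ℚ
  weight (a ∷ b ∷ l) = invDeg a ℚ.* weight (b ∷ l)

  startsAt : Fin n → List (Fin n) → Bool
  startsAt x []      = false
  startsAt x (a ∷ _) = does (a ≟ x)

  firstHitAtEnd : Fin n → List (Fin n) → Bool
  firstHitAtEnd y []          = false
  firstHitAtEnd y (a ∷ [])    = does (a ≟ y)
  firstHitAtEnd y (a ∷ b ∷ l) = not (does (a ≟ y)) ∧ firstHitAtEnd y (b ∷ l)

  probHitAt : Fin n → Fin n → ℕ → ℚ
  probHitAt x y k = go (allSeqs (suc k))
    where
      go : List (List (Fin n)) → ℚ
      go []      = 0ℚ
      go (l ∷ ls) = (if startsAt x l ∧ isWalkB l ∧ firstHitAtEnd y l
                       then weight l else 0ℚ) ℚ.+ go ls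

  sumBelow : (ℕ → ℚ) → ℕ → ℚ
  sumBelow f zero    = 0ℚ
  sumBelow f (suc K) = sumBelow f K ℚ.+ f K

  ConvergesTo : (ℕ → ℚ) → ℚ → Set
  ConvergesTo s L = ∀ ε → 0ℚ ℚ.< ε → ∃ λ N → ∀ K → N ℕ.≤ K → ℚ.∣ s K ℚ.- L ∣ ℚ.≤ ε

  -- h = H_xy = E_x[τ_y] = Σ_k k · P_x(τ_y = k), with τ_y < ∞ almost surely
  IsHittingTime : Fin n → Fin n → ℚ → Set
  IsHittingTime x y h =
      ConvergesTo (sumBelow (probHitAt x y)) 1ℚ
    × ConvergesTo (sumBelow (λ k → ((+ k) ℚ./ 1) ℚ.* probHitAt x y k)) h

ℕ→ℚ : ℕ → ℚ
ℕ→ℚ k = (+ k) ℚ./ 1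

{-# OPTIONS --safe #-}
module Submission where

-- In a tree, the distance to w drops along exactly one neighbour of v ≠ w and grows along
-- all the others, so the graph Laplacian of d(·,w) at v is 2 − 2δ(v,w) − deg v.  Hence for
-- a(w) = d(x,y) + d(w,y) − d(w,x) one has Δa = 2δ(·,x) − 2δ(·,y), and
-- H(x,y) = ½ Σ_w deg(w) a(w) solves the first-step equations of the hitting time.
-- Summation by parts of a² against Δa gives
--   16 (H(x,y) − d(x,y)²) = Σ_{w,u adjacent} (a(w) + a(u)) (4 − (a(w) − a(u))²),
-- where every term is nonnegative because a changes by −2, 0 or 2 along an edge.  This is
-- the lower bound; equality forces a to vanish on every edge along which it is constant,
-- which says that each w lies on the path from x to y or behind y.  As
-- H(x,y) + H(y,x) = 2m d(x,y), the upper bound is the lower bound for (y,x).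
--
-- The series for the hitting time converge because h = H(·,y) is bounded and the transition
-- operator Q killed at y satisfies Q h = h − 1 off y, so Q contracts h by a constant factor.

open import Defs
open import Algebra.Bundles using (CommutativeRing)
open import Data.Bool using (Bool; true; false; if_then_else_; _∧_; not; T)
open import Data.Empty using (⊥; ⊥-elim)
open import Data.Fin using (Fin; zero; suc; toℕ; _≟_)
open import Data.Fin.Properties using (toℕ-injective) renaming (suc-injective to Fin-suc-injective)
import Data.Integer as ℤ
import Data.Integer.Properties as ℤₚ
open import Data.List using (List; []; _∷_; _++_; _∷ʳ_; length; reverse; map; concatMap; allFin; tabulate)
open import Data.List.Membership.DecPropositional using (_∈?_)
open import Data.List.Membership.Propositional using (_∈_; _∉_)
open import Data.List.Properties using (∷-injectiveʳ; unfold-reverse; length-reverse; map-tabulate)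
open import Data.List.Relation.Binary.Subset.Propositional using (_⊆_)
open import Data.List.Relation.Unary.All using ([]; _∷_) renaming (lookup to All-lookup; tabulate to All-tabulate)
open import Data.List.Relation.Unary.AllPairs using ([]; _∷_)
open import Data.List.Relation.Unary.Any using (here; there)
open import Data.List.Relation.Unary.Any.Properties using (reverse⁻)
open import Data.Nat as ℕ using (ℕ; zero; suc)
import Data.Nat.ListAction as ℕL
import Data.Nat.Properties as ℕₚ
open import Data.Product using (Σ; ∃; _×_; _,_; proj₁; proj₂)
open import Data.Rational as ℚ using (ℚ; 0ℚ; 1ℚ; ½; 1/_; mkℚ)
import Data.Rational.Properties as ℚₚ
open import Data.Rational.Solver using (module +-*-Solver)
open import Data.Rational.Unnormalised as ℚᵘ using (mkℚᵘ; *≡*; *≤*)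
import Data.Rational.Unnormalised.Properties as ℚᵘₚ
open import Data.Sum as Sum using (_⊎_; inj₁; inj₂)
open import Function.Base using (_∘_; id)
open import Function.Bundles using (_⇔_; mk⇔; Equivalence)
open import Relation.Binary.Definitions using (tri<; tri≈; tri>)
open import Relation.Binary.PropositionalEquality using (_≡_; _≢_; refl; trans; cong; cong₂; subst; subst₂; module ≡-Reasoning) renaming (sym to ≡-sym)
open import Relation.Nullary using (¬_; does; yes; no; contradiction)
open import Relation.Nullary.Decidable using (dec-true; dec-false)
open import Algebra.Properties.Semiring.Sum (CommutativeRing.semiring ℚₚ.+-*-commutativeRing) using (sum; sum-cong-≗; ∑-distrib-+; ∑-comm; *-distribˡ-sum; *-distribʳ-sum)
open +-*-Solver using (solve; _:=_; _:+_; _:*_; _:-_; :-_; con)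

-- The choice of a² comes from a cancellation. Along an edge the increments of a² and of a multiply
-- to (a(w) + a(u)) (a(w) - a(u))², and on an edge of the path from x to y this is 4 (a(w) + a(u)),
-- exactly four times what the edge contributes to Σ deg · a. Path edges therefore drop out of the
-- difference. An edge off the path, in a branch attached at distance k from y, has a = 2k at both
-- ends and contributes 2k, so the identity says H(x,y) = d(x,y)² + Σ 2k over the edges off the
-- path. The hitting time is defined by series over vertex sequences, so first-step equations alone
-- do not identify `hit`. The link is through the remainders of the two series: `survival` and
-- `deficit` obey exact recursions under `Q`, stay nonnegative, and are dominated by decaying
-- multiples of h. All of this happens in ℚ: h is a finite sum, and Bernoulli's inequality turns the
-- geometric decay into a bound of order 1/K from which the required index can be read off.

-- Walks, joins, splittings and loop erasure in a graph

module TreeDistance {n : ℕ} (G : Graph n) where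
  open import Data.Nat using (_+_; _∸_; _≤_; _<_; z≤n; s≤s; s≤s⁻¹)
  open ℕₚ using (≤-refl; ≤-trans; ≤-antisym; ≤-reflexive; <-asym; m≤n+m; +-mono-≤; module ≤-Reasoning; m≤n⇒m≤1+n; +-suc; suc-injective; 1+n≰n)

  source∈ : ∀ {x y p} → IsWalk G x y p → x ∈ p
  source∈ (single x) = here refl
  source∈ (step _ _) = here refl

  walk-nonempty : ∀ {x y p} → IsWalk G x y p → 1 ≤ length p
  walk-nonempty (single x) = s≤s z≤n
  walk-nonempty (step _ _) = s≤s z≤n

  walk-snoc : ∀ {x y z p} → IsWalk G x y p → adj G y z ≡ true → IsWalk G x z (p ∷ʳ z)
  walk-snoc (single x) e = step e (single _)
  walk-snoc (step f w) e = step f (walk-snoc w e)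

  adj-sym : ∀ {x y} → adj G x y ≡ true → adj G y x ≡ true
  adj-sym {x} {y} e = trans (sym G y x) e

  walk-reverse : ∀ {x y p} → IsWalk G x y p → IsWalk G y x (reverse p)
  walk-reverse (single x) = single x
  walk-reverse {x} {y} (step {p = p} e w) =
    subst (IsWalk G y x) (≡-sym (unfold-reverse x p)) (walk-snoc (walk-reverse w) (adj-sym e))

  -- The common vertex `y` is listed once in the join, hence the `suc`. The inclusion of vertices
  -- serves to show that a join avoids a given vertex; `y ∈ r` serves to put `y` on a path once the
  -- join is known to be shortest.
  walk-join : ∀ {x y z p q} → IsWalk G x y p → IsWalk G y z q →
    ∃ λ r → IsWalk G x z r × suc (length r) ≡ length p + length q
          × (∀ {v} → v ∈ r → v ∈ p ⊎ v ∈ q) × y ∈ r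
  walk-join {q = q} (single x) w′ = q , w′ , refl , inj₂ , source∈ w′
  walk-join (step {x = x} e w) w′ with walk-join w w′
  ... | r , wr , len , r⊆ , y∈r =
    x ∷ r , step e wr , cong suc len ,
    (λ { (here v≡x) → inj₁ (here v≡x)
       ; (there v∈r) → Sum.map there id (r⊆ v∈r) }) ,
    there y∈r

  walk-split : ∀ {x y w p} → IsWalk G x y p → w ∈ p →
    ∃ λ q → ∃ λ r → IsWalk G x w q × IsWalk G w y r × suc (length p) ≡ length q + length r
  walk-split (single x) (here refl) = _ , _ , single x , single x , refl
  walk-split (step e w) (here refl) = _ , _ , single _ , step e w , refl
  walk-split (step e w) (there w∈p) with walk-split w w∈p
  ... | q , r , wq , wr , len = _ , r , step e wq , wr , cong suc len

  path-suffix : ∀ {x y w p} → IsPath G x y p → w ∈ p →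
    ∃ λ q → IsPath G w y q × q ⊆ p × length q ≤ length p
  path-suffix wu@(single x , u) (here refl) = _ , wu , id , ≤-refl
  path-suffix wu@(step e w , u) (here refl) = _ , wu , id , ≤-refl
  path-suffix (step e w , _ ∷ u) (there w∈p) with path-suffix (w , u) w∈p
  ... | q , pq , q⊆ , len = q , pq , there ∘ q⊆ , m≤n⇒m≤1+n len

  path-cons : ∀ {x z y p} → adj G x z ≡ true → IsPath G z y p → x ∉ p → IsPath G x y (x ∷ p)
  path-cons e (w , u) x∉p =
    step e w , All-tabulate (λ v∈p x≡v → x∉p (subst (_∈ _) (≡-sym x≡v) v∈p)) ∷ u

  -- Loops are erased from the tail first. If `x` reappears in the erased tail, the suffix from that
  -- occurrence is already a path from `x`; otherwise `x` can be prepended.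
  loop-erase : ∀ {x y p} → IsWalk G x y p → ∃ λ q → IsPath G x y q × q ⊆ p × length q ≤ length p
  loop-erase (single x) = _ , (single x , [] ∷ []) , id , ≤-refl
  loop-erase (step {x = x} e w) with loop-erase w
  ... | q , pq , q⊆ , len with _∈?_ _≟_ x q
  ...   | no x∉q = x ∷ q , path-cons e pq x∉q ,
                   (λ { (here v≡x) → here v≡x ; (there v∈q) → there (q⊆ v∈q) }) , s≤s len
  ...   | yes x∈q with path-suffix pq x∈q
  ...     | r , pr , r⊆ , len′ = r , pr , there ∘ q⊆ ∘ r⊆ , m≤n⇒m≤1+n (≤-trans len′ len)

  -- Unique paths and the metric of a tree

  module Tree (tree : IsTree G) where

    private
      connected = proj₁ tree
      acyclic   = proj₂ tree

    -- Two paths leaving x through distinct neighbours a and b and meeting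
    -- again yield a path from a to b avoiding x, which closes up at x.
    fork-cycle : ∀ {x a b p} → adj G x a ≡ true → adj G x b ≡ true → a ≢ b →
                 IsWalk G a b p → x ∉ p → ⊥
    fork-cycle {x} {b = b} xa xb a≢b w x∉p with loop-erase w
    ... | q , pq , q⊆ , _ =
      acyclic (x , b , x ∷ q , path-cons xa pq (x∉p ∘ q⊆) , s≤s (2≤ pq) , adj-sym xb)
      where
      2≤ : ∀ {q} → IsPath G _ b q → 2 ≤ length q
      2≤ (single _ , _) = contradiction refl a≢b
      2≤ (step _ w , _) = s≤s (walk-nonempty w)

    target∈ : ∀ {x y p} → IsWalk G x y p → y ∈ p
    target∈ (single x) = here refl
    target∈ (step _ w) = there (target∈ w)

    -- Where two paths first diverge, one tail followed by the reverse of the other is a walk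
    -- between two distinct neighbours of `x`. It misses `x` because both lists are duplicate-free,
    -- which `fork-cycle` forbids.
    path-unique : ∀ {x y p q} → IsPath G x y p → IsPath G x y q → p ≡ q
    path-unique (single x , _) (single .x , _) = refl
    path-unique (single x , _) (step e w , x# ∷ _) =
      contradiction refl (All-lookup x# (target∈ w))
    path-unique (step e w , x# ∷ _) (single x , _) =
      contradiction refl (All-lookup x# (target∈ w))
    path-unique (step {x = x} {z = a} e w , x# ∷ u) (step {z = b} f w′ , x#′ ∷ u′) with a ≟ b
    ... | yes refl = cong (x ∷_) (path-unique (w , u) (w′ , u′))
    ... | no a≢b with walk-join w (walk-reverse w′)
    ...   | r , wr , _ , r⊆ , _ = ⊥-elim (fork-cycle e f a≢b wr x∉r)
      where
      x∉r : x ∉ r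
      x∉r x∈r with r⊆ x∈r
      ... | inj₁ x∈p = All-lookup x# x∈p refl
      ... | inj₂ x∈q = All-lookup x#′ (reverse⁻ x∈q) refl

    abstract
      path : ∀ x y → ∃ λ p → IsPath G x y p
      path x y with loop-erase (proj₂ (connected x y))
      ... | p , pp , _ = p , pp

      dist : Fin n → Fin n → ℕ
      dist x y = length (proj₁ (path x y)) ∸ 1

      path-length : ∀ {x y p} → IsPath G x y p → length p ≡ suc (dist x y)
      path-length {x} {y} pp = trans (cong length (path-unique pp pq)) (pos (walk-nonempty (proj₁ pq)))
        where
        pq : IsPath G x y (proj₁ (path x y))
        pq = proj₂ (path x y)
        pos : ∀ {k} → 1 ≤ k → k ≡ suc (k ∸ 1)
        pos (s≤s _) = refl

    walk-length : ∀ {x y p} → IsWalk G x y p → suc (dist x y) ≤ length p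
    walk-length w with loop-erase w
    ... | q , pq , _ , len = subst (_≤ _) (path-length pq) len

    dist-unique : ∀ {x y d} → IsDist G x y d → d ≡ dist x y
    dist-unique {x} {y} ((p , w , len) , min) = suc-injective (≤-antisym
      (subst (_ ≤_) (path-length pq) (min _ (proj₁ pq)))
      (subst (_ ≤_) len (walk-length w)))
      where pq = proj₂ (path x y)

    dist-refl : ∀ x → dist x x ≡ 0
    dist-refl x = suc-injective (≡-sym (path-length (single x , [] ∷ [])))

    dist-sym : ∀ x y → dist x y ≡ dist y x
    dist-sym x y = ≤-antisym (half x y) (half y x)
      where
      half : ∀ x y → dist x y ≤ dist y x
      half x y with path y x
      ... | p , pp = s≤s⁻¹ (begin
        suc (dist x y)      ≤⟨ walk-length (walk-reverse (proj₁ pp)) ⟩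
        length (reverse p)  ≡⟨ length-reverse p ⟩
        length p            ≡⟨ path-length pp ⟩
        suc (dist y x)      ∎)
        where open ≤-Reasoning

    -- Besides giving the triangle inequality, this walk is the path that witnesses `OnPath` when
    -- the triangle inequality is tight.
    shortest-via : ∀ x y z →
      ∃ λ r → IsWalk G x z r × length r ≡ suc (dist x y + dist y z) × y ∈ r
    shortest-via x y z with path x y | path y z
    ... | p , pp | q , pq with walk-join (proj₁ pp) (proj₁ pq)
    ...   | r , wr , len , _ , y∈r = r , wr , suc-injective (begin
        suc (length r)                       ≡⟨ len ⟩
        length p + length q                  ≡⟨ cong₂ _+_ (path-length pp) (path-length pq) ⟩
        suc (dist x y) + suc (dist y z)      ≡⟨ cong suc (+-suc (dist x y) (dist y z)) ⟩
        suc (suc (dist x y + dist y z))      ∎) , y∈r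
        where open ≡-Reasoning

    dist-triangle : ∀ x y z → dist x z ≤ dist x y + dist y z
    dist-triangle x y z with shortest-via x y z
    ... | r , wr , len , _ = s≤s⁻¹ (≤-trans (walk-length wr) (≤-reflexive len))

    onPath⇒dist : ∀ {w x y} → OnPath G w x y → dist x w + dist w y ≡ dist x y
    onPath⇒dist {w} {x} {y} (p , pp , w∈p) with walk-split (proj₁ pp) w∈p
    ... | q , r , wq , wr , len = ≤-antisym (s≤s⁻¹ (s≤s⁻¹ (begin
        suc (suc (dist x w + dist w y))  ≡⟨ cong suc (+-suc (dist x w) (dist w y)) ⟨
        suc (dist x w) + suc (dist w y)  ≤⟨ +-mono-≤ (walk-length wq) (walk-length wr) ⟩
        length q + length r              ≡⟨ len ⟨
        suc (length p)                   ≡⟨ cong suc (path-length pp) ⟩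
        suc (suc (dist x y))             ∎)))
      (dist-triangle x w y)
      where open ≤-Reasoning

    -- The tail of a shortest walk is shortest, since its loop erasure preceded by `x` cannot be
    -- shorter than the distance. If `x` occurred in the tail, the suffix from there would be a path
    -- from `x` to `y` with too few vertices.
    shortest⇒path : ∀ {x y p} → IsWalk G x y p → length p ≡ suc (dist x y) → IsPath G x y p
    shortest⇒path (single x) _ = single x , [] ∷ []
    shortest⇒path {y = y} (step {x = x} {z} {p = p} e w) len = path-cons e (shortest⇒path w lenp) x∉p
      where
      open ≤-Reasoning
      lenp : length p ≡ suc (dist z y)
      lenp with loop-erase w
      ... | q , pq , _ , len′ = ≤-antisym (begin
              length p         ≡⟨ suc-injective len ⟩
              dist x y         ≤⟨ s≤s⁻¹ (walk-length (step e (proj₁ pq))) ⟩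
              length q         ≡⟨ path-length pq ⟩
              suc (dist z y)   ∎)
            (walk-length w)
      x∉p : x ∉ p
      x∉p x∈p with path-suffix (shortest⇒path w lenp) x∈p
      ... | q , pq , _ , len′ = 1+n≰n (begin
        suc (length p)  ≡⟨ len ⟩
        suc (dist x y)  ≡⟨ path-length pq ⟨
        length q        ≤⟨ len′ ⟩
        length p        ∎)

    dist⇒onPath : ∀ {w x y} → dist x w + dist w y ≡ dist x y → OnPath G w x y
    dist⇒onPath {w} {x} {y} eq with shortest-via x w y
    ... | r , wr , len , w∈r = r , shortest⇒path wr (trans len (cong suc eq)) , w∈r

    dist≡0⇒≡ : ∀ {x y} → dist x y ≡ 0 → x ≡ y
    dist≡0⇒≡ {x} {y} d≡0 = go (proj₂ (path x y)) (trans (path-length (proj₂ (path x y))) (cong suc d≡0))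
      where
      go : ∀ {p} → IsPath G x y p → length p ≡ 1 → x ≡ y
      go (single _ , _) _ = refl
      go (step _ (step _ _) , _) ()

    cons-path-dist : ∀ {u v w p} → IsPath G u w p → IsPath G v w (v ∷ p) → dist v w ≡ suc (dist u w)
    cons-path-dist pp pv = suc-injective (trans (≡-sym (path-length pv)) (cong suc (path-length pp)))

    onPath-closer : ∀ {u v w p} → u ≢ v → IsPath G u w p → v ∈ p → dist v w < dist u w
    onPath-closer {u} {v} {w} u≢v pp v∈p with dist u v in eq | onPath⇒dist (_ , pp , v∈p)
    ... | zero  | _ = contradiction (dist≡0⇒≡ eq) u≢v
    ... | suc k | e = ≤-trans (s≤s (m≤n+m (dist v w) k)) (≤-reflexive e)

    adj⇒≢ : ∀ {u v} → adj G u v ≡ true → u ≢ v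
    adj⇒≢ {u} e refl with trans (≡-sym e) (irrefl G u)
    ... | ()

    -- If the path from one endpoint to `w` avoids the other endpoint, prepending the latter gives
    -- its path to `w`. Both paths cannot meet the opposite endpoint, as each endpoint would then be
    -- strictly closer to `w` than the other. Equal distances never occur, so a tree is bipartite.
    neighbour-dist : ∀ {v u} w → adj G v u ≡ true →
                     dist u w ≡ suc (dist v w) ⊎ dist v w ≡ suc (dist u w)
    neighbour-dist {v} {u} w e with _∈?_ _≟_ v (proj₁ (path u w)) | _∈?_ _≟_ u (proj₁ (path v w))
    ... | no v∉p  | _       = inj₂ (cons-path-dist (proj₂ (path u w)) (path-cons e (proj₂ (path u w)) v∉p))
    ... | yes v∈p | no u∉q  = inj₁ (cons-path-dist (proj₂ (path v w)) (path-cons (adj-sym e) (proj₂ (path v w)) u∉q))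
    ... | yes v∈p | yes u∈q = contradiction (onPath-closer (adj⇒≢ e ∘ ≡-sym) (proj₂ (path u w)) v∈p)
                                (<-asym (onPath-closer (adj⇒≢ e) (proj₂ (path v w)) u∈q))

    closer-neighbour : ∀ {v w} → v ≢ w → ∃ λ u → adj G v u ≡ true × dist v w ≡ suc (dist u w)
    closer-neighbour {v} {w} v≢w = go (proj₂ (path v w))
      where
      go : ∀ {p} → IsPath G v w p → ∃ λ u → adj G v u ≡ true × dist v w ≡ suc (dist u w)
      go (single _ , _) = contradiction refl v≢w
      go pv@(step {z = u} e pw , _ ∷ uniq) = u , e , cons-path-dist (pw , uniq) pv

    -- Both neighbours continue to a shortest walk from `v` to `w`, hence to the same path, and its
    -- second vertex determines them.
    closer-neighbour-unique : ∀ {v w u u′} → adj G v u ≡ true → adj G v u′ ≡ true →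
      dist v w ≡ suc (dist u w) → dist v w ≡ suc (dist u′ w) → u ≡ u′
    closer-neighbour-unique {v} {w} {u} {u′} e e′ c c′ =
      source-unique (proj₁ pu) (subst (IsWalk G u′ w) (∷-injectiveʳ (path-unique (extend e′ c′) (extend e c))) (proj₁ (proj₂ (path u′ w))))
      where
      pu = proj₂ (path u w)
      extend : ∀ {u} → adj G v u ≡ true → dist v w ≡ suc (dist u w) → IsPath G v w (v ∷ proj₁ (path u w))
      extend {u} e c = shortest⇒path (step e (proj₁ (proj₂ (path u w))))
                                     (cong suc (trans (path-length (proj₂ (path u w))) (≡-sym c)))
      source-unique : ∀ {x x′ y p} → IsWalk G x y p → IsWalk G x′ y p → x ≡ x′
      source-unique (single _) (single _) = refl
      source-unique (single _) (step _ _) = refl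
      source-unique (step _ _) (single _) = refl
      source-unique (step _ _) (step _ _) = refl

-- Rational arithmetic, finite sums and a convergence criterion

module RationalSums where
  open import Data.Rational using (_+_; _*_; _-_; -_; _≤_)
  open ℚₚ using (≤-refl; ≤-trans; ≤-reflexive; ≤-antisym; +-mono-≤; +-identityˡ; +-identityʳ; *-identityˡ; *-zeroˡ; *-zeroʳ; *-monoˡ-≤-nonNeg)

  2ℚ 4ℚ : ℚ
  2ℚ = 1ℚ + 1ℚ
  4ℚ = 2ℚ + 2ℚ

  abstract
    -- Opaque, so that values such as `fromℕ (dist x y)` remain atoms for the ring solver and
    -- fractions are not normalised during type checking; `fromℕ-def` is the bridge back to `ℕ→ℚ`.
    fromℕ : ℕ → ℚ
    fromℕ = ℕ→ℚ

    fromℕ-def : ∀ k → fromℕ k ≡ ℕ→ℚ k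
    fromℕ-def _ = refl

    private
      unnormalise : ∀ k → ℚ.toℚᵘ (fromℕ k) ℚᵘ.≃ mkℚᵘ (ℤ.+ k) 0
      unnormalise k = ℚₚ.toℚᵘ-fromℚᵘ (mkℚᵘ (ℤ.+ k) 0)

    fromℕ-0 : fromℕ 0 ≡ 0ℚ
    fromℕ-0 = refl

    fromℕ-1 : fromℕ 1 ≡ 1ℚ
    fromℕ-1 = refl

    fromℕ-+ : ∀ m n → fromℕ (m ℕ.+ n) ≡ fromℕ m + fromℕ n
    fromℕ-+ m n = ℚₚ.toℚᵘ-injective (ℚᵘₚ.≃-trans (unnormalise (m ℕ.+ n))
      (ℚᵘₚ.≃-sym (ℚᵘₚ.≃-trans (ℚₚ.toℚᵘ-homo-+ (fromℕ m) (fromℕ n))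
        (ℚᵘₚ.≃-trans (ℚᵘₚ.+-cong (unnormalise m) (unnormalise n))
          (*≡* (cong (ℤ._* ℤ.+ 1) (cong₂ ℤ._+_ (ℤₚ.*-identityʳ (ℤ.+ m)) (ℤₚ.*-identityʳ (ℤ.+ n)))))))))

    fromℕ-* : ∀ m n → fromℕ (m ℕ.* n) ≡ fromℕ m * fromℕ n
    fromℕ-* m n = ℚₚ.toℚᵘ-injective (ℚᵘₚ.≃-trans (unnormalise (m ℕ.* n))
      (ℚᵘₚ.≃-sym (ℚᵘₚ.≃-trans (ℚₚ.toℚᵘ-homo-* (fromℕ m) (fromℕ n))
        (ℚᵘₚ.≃-trans (ℚᵘₚ.*-cong (unnormalise m) (unnormalise n))
          (*≡* (cong (ℤ._* ℤ.+ 1) (≡-sym (ℤₚ.pos-* m n))))))))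

    fromℕ-mono-≤ : ∀ {m n} → m ℕ.≤ n → fromℕ m ≤ fromℕ n
    fromℕ-mono-≤ {m} {n} m≤n = ℚₚ.toℚᵘ-cancel-≤
      (ℚᵘₚ.≤-respˡ-≃ (ℚᵘₚ.≃-sym (unnormalise m)) (ℚᵘₚ.≤-respʳ-≃ (ℚᵘₚ.≃-sym (unnormalise n))
        (*≤* (ℤₚ.*-monoʳ-≤-nonNeg (ℤ.+ 1) (ℤ.+≤+ m≤n)))))

    fromℕ-cancel-≤ : ∀ {m n} → fromℕ m ≤ fromℕ n → m ℕ.≤ n
    fromℕ-cancel-≤ {m} {n} le with ℚᵘₚ.≤-respˡ-≃ (unnormalise m) (ℚᵘₚ.≤-respʳ-≃ (unnormalise n) (ℚₚ.toℚᵘ-mono-≤ le))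
    ... | *≤* le′ = ℤₚ.drop‿+≤+ (subst₂ ℤ._≤_ (ℤₚ.*-identityʳ (ℤ.+ m)) (ℤₚ.*-identityʳ (ℤ.+ n)) le′)

    -- The denominator is at least 1, so the numerator itself is a bound.
    ≤-archimedean : ∀ q → ∃ λ k → q ≤ fromℕ k
    ≤-archimedean q@(mkℚ (ℤ.+ k) d-1 _) = k , ℚₚ.toℚᵘ-cancel-≤ (ℚᵘₚ.≤-respʳ-≃ (ℚᵘₚ.≃-sym (unnormalise k))
      (*≤* (subst (ℤ._≤ ℤ.+ k ℤ.* ℤ.+ suc d-1) (≡-sym (ℤₚ.*-identityʳ (ℤ.+ k)))
         (subst (ℤ._≤_ (ℤ.+ k)) (ℤₚ.pos-* k (suc d-1)) (ℤ.+≤+ (ℕₚ.m≤m*n k (suc d-1)))))))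
    ≤-archimedean q@(mkℚ (ℤ.-[1+ k ]) d-1 _) = 0 , ℚₚ.<⇒≤ (ℚₚ.negative⁻¹ q)

  fromℕ-suc : ∀ k → fromℕ (suc k) ≡ fromℕ k + 1ℚ
  fromℕ-suc k = trans (fromℕ-+ 1 k) (trans (cong (_+ fromℕ k) fromℕ-1) (ℚₚ.+-comm 1ℚ (fromℕ k)))

  0≤fromℕ : ∀ k → 0ℚ ≤ fromℕ k
  0≤fromℕ k = subst (_≤ fromℕ k) fromℕ-0 (fromℕ-mono-≤ ℕ.z≤n)

  fromℕ-injective : ∀ {m n} → fromℕ m ≡ fromℕ n → m ≡ n
  fromℕ-injective eq =
    ℕₚ.≤-antisym (fromℕ-cancel-≤ (≤-reflexive eq)) (fromℕ-cancel-≤ (≤-reflexive (≡-sym eq)))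

  0≤1 : 0ℚ ≤ 1ℚ
  0≤1 = subst (0ℚ ≤_) fromℕ-1 (0≤fromℕ 1)

  0≤+ : ∀ {p q} → 0ℚ ≤ p → 0ℚ ≤ q → 0ℚ ≤ p + q
  0≤+ {p} {q} 0≤p 0≤q = subst (_≤ p + q) (+-identityˡ 0ℚ) (+-mono-≤ 0≤p 0≤q)

  0≤* : ∀ {p q} → 0ℚ ≤ p → 0ℚ ≤ q → 0ℚ ≤ p * q
  0≤* {p} {q} 0≤p 0≤q = subst (_≤ p * q) (*-zeroʳ p) (*-monoˡ-≤-nonNeg p {{ℚ.nonNegative 0≤p}} 0≤q)

  *-monoˡ : ∀ {p q r} → 0ℚ ≤ r → p ≤ q → r * p ≤ r * q
  *-monoˡ {r = r} 0≤r = *-monoˡ-≤-nonNeg r {{ℚ.nonNegative 0≤r}}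

  ≤⇒0≤- : ∀ {p q} → p ≤ q → 0ℚ ≤ q - p
  ≤⇒0≤- {p} {q} p≤q = subst (_≤ q - p) (ℚₚ.+-inverseʳ p) (ℚₚ.+-monoˡ-≤ (- p) p≤q)

  ≤-witness : ∀ {p q} r → 0ℚ ≤ r → q ≡ p + r → p ≤ q
  ≤-witness {p} r 0≤r refl = subst (_≤ p + r) (+-identityʳ p) (ℚₚ.+-monoʳ-≤ p 0≤r)

  module _ {n : ℕ} where
    δ : Fin n → Fin n → ℚ
    δ v w = if does (v ≟ w) then 1ℚ else 0ℚ

    δ-refl : ∀ v → δ v v ≡ 1ℚ
    δ-refl v = cong (if_then 1ℚ else 0ℚ) (dec-true (v ≟ v) refl)

    δ-≢ : ∀ {v w} → v ≢ w → δ v w ≡ 0ℚ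
    δ-≢ {v} {w} v≢w = cong (if_then 1ℚ else 0ℚ) (dec-false (v ≟ w) v≢w)

    δ-sym : ∀ v w → δ v w ≡ δ w v
    δ-sym v w with v ≟ w
    ... | yes refl = ≡-sym (δ-refl v)
    ... | no v≢w   = ≡-sym (δ-≢ (v≢w ∘ ≡-sym))

  sum-0 : ∀ {n} (f : Fin n → ℚ) → (∀ i → f i ≡ 0ℚ) → sum f ≡ 0ℚ
  sum-0 {zero}  f f≡0 = refl
  sum-0 {suc n} f f≡0 = trans (cong₂ _+_ (f≡0 zero) (sum-0 (f ∘ suc) (f≡0 ∘ suc))) (+-identityˡ 0ℚ)

  sum-single : ∀ {n} (f : Fin n → ℚ) i → (∀ j → j ≢ i → f j ≡ 0ℚ) → sum f ≡ f i
  sum-single f zero f≡0 =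
    trans (cong (f zero +_) (sum-0 (f ∘ suc) λ j → f≡0 (suc j) λ ())) (+-identityʳ (f zero))
  sum-single f (suc i) f≡0 =
    trans (cong₂ _+_ (f≡0 zero λ ()) (sum-single (f ∘ suc) i λ j j≢i → f≡0 (suc j) (j≢i ∘ Fin-suc-injective)))
          (+-identityˡ (f (suc i)))

  sum-δ : ∀ {n} (f : Fin n → ℚ) i → sum (λ j → δ j i * f j) ≡ f i
  sum-δ f i = trans (sum-single _ i λ j j≢i → trans (cong (_* f j) (δ-≢ j≢i)) (*-zeroˡ (f j)))
                    (trans (cong (_* f i) (δ-refl i)) (*-identityˡ (f i)))

  sum-nonneg : ∀ {n} (f : Fin n → ℚ) → (∀ i → 0ℚ ≤ f i) → 0ℚ ≤ sum f
  sum-nonneg {zero}  f 0≤f = ≤-refl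
  sum-nonneg {suc n} f 0≤f = 0≤+ (0≤f zero) (sum-nonneg (f ∘ suc) (0≤f ∘ suc))

  term≤sum : ∀ {n} (f : Fin n → ℚ) → (∀ i → 0ℚ ≤ f i) → ∀ i → f i ≤ sum f
  term≤sum f 0≤f zero    = ≤-witness _ (sum-nonneg (f ∘ suc) (0≤f ∘ suc)) refl
  term≤sum f 0≤f (suc i) =
    ≤-trans (term≤sum (f ∘ suc) (0≤f ∘ suc) i) (≤-witness _ (0≤f zero) (ℚₚ.+-comm (f zero) _))

  sum-nonneg≡0 : ∀ {n} (f : Fin n → ℚ) → (∀ i → 0ℚ ≤ f i) → sum f ≡ 0ℚ → ∀ i → f i ≡ 0ℚ
  sum-nonneg≡0 f 0≤f eq i = ≤-antisym (subst (f i ≤_) eq (term≤sum f 0≤f i)) (0≤f i)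

  sum-- : ∀ {n} (f g : Fin n → ℚ) → sum (λ i → f i - g i) ≡ sum f - sum g
  sum-- {zero}  f g = refl
  sum-- {suc n} f g = trans (cong (f zero - g zero +_) (sum-- (f ∘ suc) (g ∘ suc)))
    (solve 4 (λ a b c d → a :- b :+ (c :- d) := a :+ c :- (b :+ d)) refl
      (f zero) (g zero) (sum (f ∘ suc)) (sum (g ∘ suc)))

  fromℕ-sum : ∀ {n} (f : Fin n → ℕ) → fromℕ (ℕL.sum (map f (allFin n))) ≡ sum (fromℕ ∘ f)
  fromℕ-sum {n} f = trans (cong (fromℕ ∘ ℕL.sum) (map-tabulate id f)) (tab n f)
    where
    tab : ∀ n (f : Fin n → ℕ) → fromℕ (ℕL.sum (tabulate f)) ≡ sum (fromℕ ∘ f)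
    tab zero    f = fromℕ-0
    tab (suc n) f = trans (fromℕ-+ (f zero) _) (cong (fromℕ (f zero) +_) (tab n (f ∘ suc)))

  reciprocal : ∀ k → (ℤ.+ 1 ℚ./ suc k) * fromℕ (suc k) ≡ 1ℚ
  reciprocal k = trans (cong ((ℤ.+ 1 ℚ./ suc k) *_) (fromℕ-def (suc k))) (ℚₚ.toℚᵘ-injective
    (ℚᵘₚ.≃-trans (ℚₚ.toℚᵘ-homo-* (ℤ.+ 1 ℚ./ suc k) (ℕ→ℚ (suc k)))
      (ℚᵘₚ.≃-trans (ℚᵘₚ.*-cong (ℚₚ.toℚᵘ-fromℚᵘ (mkℚᵘ (ℤ.+ 1) k)) (ℚₚ.toℚᵘ-fromℚᵘ (mkℚᵘ (ℤ.+ suc k) 0)))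
        (*≡* (cong ℤ.+_ (cong suc (trans (ℕₚ.*-identityʳ (k ℕ.+ 0)) (cong (ℕ._+ 0) (≡-sym (ℕₚ.*-identityʳ k))))))))))

  module _ {a} {X : Set a} where
    listSum : (X → ℚ) → List X → ℚ
    listSum f []       = 0ℚ
    listSum f (x ∷ xs) = f x + listSum f xs

    listSum-unique : ∀ f (g : List X → ℚ) → g [] ≡ 0ℚ → (∀ x xs → g (x ∷ xs) ≡ f x + g xs) →
                     ∀ xs → g xs ≡ listSum f xs
    listSum-unique f g nil cons []       = nil
    listSum-unique f g nil cons (x ∷ xs) = trans (cons x xs) (cong (f x +_) (listSum-unique f g nil cons xs))

    listSum-++ : ∀ f xs ys → listSum f (xs ++ ys) ≡ listSum f xs + listSum f ys
    listSum-++ f []       ys = ≡-sym (+-identityˡ (listSum f ys))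
    listSum-++ f (x ∷ xs) ys = trans (cong (f x +_) (listSum-++ f xs ys)) (≡-sym (ℚₚ.+-assoc (f x) (listSum f xs) (listSum f ys)))

    listSum-scale : ∀ {f g : X → ℚ} c → (∀ x → f x ≡ c * g x) → ∀ xs → listSum f xs ≡ c * listSum g xs
    listSum-scale c h []       = ≡-sym (*-zeroʳ c)
    listSum-scale {g = g} c h (x ∷ xs) = trans (cong₂ _+_ (h x) (listSum-scale c h xs)) (≡-sym (ℚₚ.*-distribˡ-+ c (g x) (listSum g xs)))

  -- A remainder of order 1/K suffices: the threshold is an integer above C/ε. The bound starts at
  -- index `suc K`, whose positivity allows that factor to be cancelled.
  converges : ∀ {n} (G : Graph n) {s : ℕ → ℚ} (e : ℕ → ℚ) l C → (∀ K → s K ≡ l - e K) → (∀ K → 0ℚ ≤ e K) →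
              (∀ K → fromℕ (suc K) * e (suc K) ≤ C) → ConvergesTo G s l
  converges G {s} e l C s≡ 0≤e bound ε 0<ε = suc N , close
    where
    instance
      ε-positive : ℚ.Positive ε
      ε-positive = ℚ.positive 0<ε
      ε-nonZero : ℚ.NonZero ε
      ε-nonZero = ℚₚ.pos⇒nonZero ε
    N : ℕ
    N = proj₁ (≤-archimedean (C * 1/ ε))
    C≤ : C ≤ ε * fromℕ N
    C≤ = subst (_≤ ε * fromℕ N)
      (trans (solve 3 (λ e c i → e :* (c :* i)
          := c :* (e :* i)) refl ε C (1/ ε)) (trans (cong (C *_) (ℚₚ.*-inverseʳ ε)) (ℚₚ.*-identityʳ C)))
      (*-monoˡ (ℚₚ.<⇒≤ 0<ε) (proj₂ (≤-archimedean (C * 1/ ε))))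
    close : ∀ K → suc N ℕ.≤ K → ℚ.∣ s K - l ∣ ≤ ε
    close (suc K) (ℕ.s≤s N≤K) = subst (_≤ ε) (≡-sym abs) e≤ε
      where
      instance
        K-positive : ℚ.Positive (fromℕ (suc K))
        K-positive = ℚ.positive (ℚₚ.<-≤-trans (ℚₚ.positive⁻¹ 1ℚ) (subst (_≤ fromℕ (suc K)) fromℕ-1 (fromℕ-mono-≤ (ℕ.s≤s ℕ.z≤n))))
      abs : ℚ.∣ s (suc K) - l ∣ ≡ e (suc K)
      abs = trans (cong (λ t → ℚ.∣ t - l ∣) (s≡ (suc K)))
        (trans (cong ℚ.∣_∣ (solve 2 (λ l e → l :- e :- l := :- e) refl l (e (suc K))))
          (trans (ℚₚ.∣-p∣≡∣p∣ (e (suc K))) (ℚₚ.0≤p⇒∣p∣≡p (0≤e (suc K)))))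
      e≤ε : e (suc K) ≤ ε
      e≤ε = ℚₚ.*-cancelˡ-≤-pos (fromℕ (suc K)) (ℚₚ.≤-trans (bound K) (ℚₚ.≤-trans C≤
        (subst (ε * fromℕ N ≤_) (ℚₚ.*-comm ε (fromℕ (suc K))) (*-monoˡ (ℚₚ.<⇒≤ 0<ε) (fromℕ-mono-≤ (ℕₚ.m≤n⇒m≤1+n N≤K))))))

-- Adjacency sums, the handshake identity and the Laplacian

module RandomWalk {n : ℕ} (G : Graph n) where
  open import Data.Rational using (_+_; _*_; _-_; -_; _≤_)
  open ℚₚ using (≤-refl; *-identityˡ; *-zeroˡ; *-zeroʳ; +-identityˡ; +-identityʳ)
  open RationalSums
  open TreeDistance G
  open ≡-Reasoning

  A : Fin n → Fin n → ℚ
  A v u = if adj G v u then 1ℚ else 0ℚ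

  A-adj : ∀ {v u} → adj G v u ≡ true → A v u ≡ 1ℚ
  A-adj = cong (if_then 1ℚ else 0ℚ)

  A-nonadj : ∀ {v u} → adj G v u ≡ false → A v u ≡ 0ℚ
  A-nonadj = cong (if_then 1ℚ else 0ℚ)

  A-sym : ∀ v u → A v u ≡ A u v
  A-sym v u = cong (if_then 1ℚ else 0ℚ) (sym G v u)

  0≤A : ∀ v u → 0ℚ ≤ A v u
  0≤A v u with adj G v u
  ... | true  = 0≤1
  ... | false = ≤-refl

  A-cong : ∀ v u {p q} → (adj G v u ≡ true → p ≡ q) → A v u * p ≡ A v u * q
  A-cong v u {p} {q} h with adj G v u
  ... | true  = cong (1ℚ *_) (h refl)
  ... | false = trans (*-zeroˡ p) (≡-sym (*-zeroˡ q))

  degree : Fin n → ℚ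
  degree v = sum (A v)

  indicator : ∀ b → fromℕ (if b then 1 else 0) ≡ (if b then 1ℚ else 0ℚ)
  indicator true  = fromℕ-1
  indicator false = fromℕ-0

  fromℕ-deg : ∀ v → fromℕ (deg G v) ≡ degree v
  fromℕ-deg v = trans (fromℕ-sum (λ u → if adj G v u then 1 else 0)) (sum-cong-≗ λ u → indicator (adj G v u))

  -- Every unordered pair of adjacent vertices is counted by `edges` in exactly one orientation.
  handshake : sum degree ≡ fromℕ (2 ℕ.* edges G)
  handshake = begin
    sum (λ i → sum (λ j → A i j))                       ≡⟨ sum-cong-≗ (λ i → sum-cong-≗ (orient i)) ⟩
    sum (λ i → sum (λ j → up i j + up j i))             ≡⟨ sum-cong-≗ (λ i → ∑-distrib-+ (up i) (λ j → up j i)) ⟩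
    sum (λ i → sum (up i) + sum (λ j → up j i))         ≡⟨ ∑-distrib-+ (λ i → sum (up i)) (λ i → sum (λ j → up j i)) ⟩
    ups + sum (λ i → sum (λ j → up j i))                ≡⟨ cong (ups +_) (∑-comm (λ i j → up j i)) ⟩
    ups + ups                                           ≡⟨ cong₂ _+_ ups≡ ups≡ ⟩
    fromℕ (edges G) + fromℕ (edges G)                   ≡⟨ fromℕ-+ (edges G) (edges G) ⟨
    fromℕ (edges G ℕ.+ edges G)                         ≡⟨ cong (λ k → fromℕ (edges G ℕ.+ k)) (ℕₚ.+-identityʳ (edges G)) ⟨
    fromℕ (2 ℕ.* edges G)                               ∎
    where
    upᵇ : Fin n → Fin n → Bool
    upᵇ i j = adj G i j ∧ (toℕ i ℕ.<ᵇ toℕ j)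
    up¹ : Fin n → Fin n → ℕ
    up¹ i j = if upᵇ i j then 1 else 0
    up : Fin n → Fin n → ℚ
    up i j = if upᵇ i j then 1ℚ else 0ℚ
    ups : ℚ
    ups = sum (λ i → sum (up i))
    ups≡ : ups ≡ fromℕ (edges G)
    ups≡ = ≡-sym (trans (fromℕ-sum (λ i → ℕL.sum (map (up¹ i) (allFin n))))
      (sum-cong-≗ λ i → trans (fromℕ-sum (up¹ i)) (sum-cong-≗ λ j → indicator (upᵇ i j))))
    <ᵇ-true : ∀ {i j} → i ℕ.< j → (i ℕ.<ᵇ j) ≡ true
    <ᵇ-true {i} {j} lt with i ℕ.<ᵇ j | ℕₚ.<⇒<ᵇ lt
    ... | true | _ = refl
    <ᵇ-false : ∀ {i j} → ¬ i ℕ.< j → (i ℕ.<ᵇ j) ≡ false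
    <ᵇ-false {i} {j} ≮ with i ℕ.<ᵇ j in eq
    ... | true  = contradiction (ℕₚ.<ᵇ⇒< i j (subst T (≡-sym eq) _)) ≮
    ... | false = refl
    orient : ∀ i j → A i j ≡ up i j + up j i
    orient i j rewrite sym G j i with adj G i j in eq
    ... | false = refl
    ... | true with ℕₚ.<-cmp (toℕ i) (toℕ j)
    ...   | tri< a _ c rewrite <ᵇ-true a | <ᵇ-false c = refl
    ...   | tri> a _ c rewrite <ᵇ-true c | <ᵇ-false a = refl
    ...   | tri≈ _ b _ with toℕ-injective b
    ...     | refl with trans (≡-sym eq) (irrefl G i)
    ...       | ()

  lap : (Fin n → ℚ) → Fin n → ℚ
  lap f v = sum (λ u → A v u * (f v - f u))

  lap-- : ∀ f g v → lap (λ u → f u - g u) v ≡ lap f v - lap g v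
  lap-- f g v = trans
    (sum-cong-≗ λ u → solve 5 (λ a p q r s → a :* (p :- q :- (r :- s)) := a :* (p :- r) :- a :* (q :- s)) refl
                        (A v u) (f v) (g v) (f u) (g u))
    (sum-- (λ u → A v u * (f v - f u)) (λ u → A v u * (g v - g u)))

  lap-+const : ∀ c f v → lap (λ u → c + f u) v ≡ lap f v
  lap-+const c f v = sum-cong-≗ λ u →
    solve 4 (λ a c p r → a :* (c :+ p :- (c :+ r)) := a :* (p :- r)) refl (A v u) c (f v) (f u)

  -- This trades a term symmetric in `w` and `u` for a one-sided one, in which a factor depending on
  -- `w` alone can leave the inner sum so that a Laplacian remains.
  symmetrise : ∀ (f : Fin n → Fin n → ℚ) →
    sum (λ w → sum (λ u → A w u * (f w u + f u w))) ≡ 2ℚ * sum (λ w → sum (λ u → A w u * f w u))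
  symmetrise f = begin
    sum (λ w → sum (λ u → A w u * (f w u + f u w)))
      ≡⟨ sum-cong-≗ (λ w → trans (sum-cong-≗ λ u → trans (ℚₚ.*-distribˡ-+ (A w u) (f w u) (f u w)) (cong (λ a → A w u * f w u + a * f u w) (A-sym w u)))
                                  (∑-distrib-+ (λ u → A w u * f w u) (λ u → A u w * f u w))) ⟩
    sum (λ w → sum (λ u → A w u * f w u) + sum (λ u → A u w * f u w))
      ≡⟨ ∑-distrib-+ (λ w → sum (λ u → A w u * f w u)) (λ w → sum (λ u → A u w * f u w)) ⟩
    S + sum (λ w → sum (λ u → A u w * f u w))
      ≡⟨ cong (S +_) (∑-comm (λ w u → A u w * f u w)) ⟩
    S + S
      ≡⟨ solve 1 (λ s → s :+ s := con 2ℚ :* s) refl S ⟩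
    2ℚ * S ∎
    where
    S : ℚ
    S = sum (λ w → sum (λ u → A w u * f w u))

  -- Hitting probabilities as iterates of the killed transition operator

  listSum-allSeqs : ∀ (f : List (Fin n) → ℚ) k →
    listSum f (allSeqs G (suc k)) ≡ sum (λ v → listSum (λ l → f (v ∷ l)) (allSeqs G k))
  listSum-allSeqs f k = over n id
    where
    prepend : ∀ v ls → listSum f (map (v ∷_) ls) ≡ listSum (λ l → f (v ∷ l)) ls
    prepend v []       = refl
    prepend v (l ∷ ls) = cong (f (v ∷ l) +_) (prepend v ls)
    -- An arbitrary `g` is needed for the induction: `allFin n` is `tabulate id`, and its tail
    -- tabulates a shifted function.
    over : ∀ m (g : Fin m → Fin n) →
      listSum f (concatMap (λ v → map (v ∷_) (allSeqs G k)) (tabulate g)) ≡ sum (λ i → listSum (λ l → f (g i ∷ l)) (allSeqs G k))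
    over zero    g = refl
    over (suc m) g = trans (listSum-++ f (map (g zero ∷_) (allSeqs G k)) _)
      (cong₂ _+_ (prepend (g zero) (allSeqs G k)) (over m (g ∘ suc)))

  hitWeight : Fin n → Fin n → List (Fin n) → ℚ
  hitWeight x y l = if startsAt G x l ∧ isWalkB G l ∧ firstHitAtEnd G y l then weight G l else 0ℚ

  -- The summation local to `probHitAt` cannot be named; abstracting over the list it is
  -- applied to lets unification find it as the value of `localSum`.
  mutual
    localSum : Fin n → Fin n → ℕ → List (List (Fin n)) → ℚ
    localSum = _

    probHitAt-listSum : ∀ x y k → probHitAt G x y k ≡ listSum (hitWeight x y) (allSeqs G (suc k))
    probHitAt-listSum x y k with allSeqs G (suc k)
    ... | ls = localSum≡listSum x y k ls

    localSum≡listSum : ∀ x y k ls → localSum x y k ls ≡ listSum (hitWeight x y) ls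
    localSum≡listSum x y k = listSum-unique (hitWeight x y) (localSum x y k) refl (λ _ _ → refl)

  probFrom : Fin n → Fin n → List (Fin n) → ℚ
  probFrom y x l = if isWalkB G (x ∷ l) ∧ firstHitAtEnd G y (x ∷ l) then weight G (x ∷ l) else 0ℚ

  probHitAt-from : ∀ x y k → probHitAt G x y k ≡ listSum (probFrom y x) (allSeqs G k)
  probHitAt-from x y k = begin
    probHitAt G x y k
      ≡⟨ probHitAt-listSum x y k ⟩
    listSum (hitWeight x y) (allSeqs G (suc k))
      ≡⟨ listSum-allSeqs (hitWeight x y) k ⟩
    sum (λ v → listSum (λ l → hitWeight x y (v ∷ l)) (allSeqs G k))
      ≡⟨ sum-cong-≗ (λ v → listSum-scale {g = probFrom y v} (δ v x) (starts v) (allSeqs G k)) ⟩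
    sum (λ v → δ v x * listSum (probFrom y v) (allSeqs G k))
      ≡⟨ sum-δ (λ v → listSum (probFrom y v) (allSeqs G k)) x ⟩
    listSum (probFrom y x) (allSeqs G k) ∎
    where
    starts : ∀ v l → hitWeight x y (v ∷ l) ≡ δ v x * probFrom y v l
    starts v l with does (v ≟ x)
    ... | true  = ≡-sym (*-identityˡ (probFrom y v l))
    ... | false = ≡-sym (*-zeroˡ (probFrom y v l))

  module Killed (y : Fin n) where

    -- Killing acts on departures: only the row of `y` is zero. Neighbours of `y` still read `f y`,
    -- so that arrival at `y` is counted.
    Q : (Fin n → ℚ) → Fin n → ℚ
    Q f x = (1ℚ - δ x y) * (invDeg G x * sum (λ u → A x u * f u))

    probHitAt-zero : ∀ x → probHitAt G x y 0 ≡ δ x y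
    probHitAt-zero x = trans (probHitAt-from x y 0) (+-identityʳ (δ x y))

    probHitAt-suc : ∀ k x → probHitAt G x y (suc k) ≡ Q (λ u → probHitAt G u y k) x
    probHitAt-suc k x = begin
      probHitAt G x y (suc k)
        ≡⟨ probHitAt-from x y (suc k) ⟩
      listSum (probFrom y x) (allSeqs G (suc k))
        ≡⟨ listSum-allSeqs (probFrom y x) k ⟩
      sum (λ u → listSum (λ l → probFrom y x (u ∷ l)) (allSeqs G k))
        ≡⟨ sum-cong-≗ (λ u → trans
             (listSum-scale {g = probFrom y u} ((1ℚ - δ x y) * (invDeg G x * A x u)) (first-step u) (allSeqs G k))
             (trans (cong ((1ℚ - δ x y) * (invDeg G x * A x u) *_) (≡-sym (probHitAt-from u y k)))
               (solve 4 (λ c i a p → c :* (i :* a) :* p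
                   := c :* i :* (a :* p)) refl (1ℚ - δ x y) (invDeg G x) (A x u) (probHitAt G u y k)))) ⟩
      sum (λ u → (1ℚ - δ x y) * invDeg G x * (A x u * probHitAt G u y k))
        ≡⟨ *-distribˡ-sum ((1ℚ - δ x y) * invDeg G x) (λ u → A x u * probHitAt G u y k) ⟨
      (1ℚ - δ x y) * invDeg G x * sum (λ u → A x u * probHitAt G u y k)
        ≡⟨ ℚₚ.*-assoc (1ℚ - δ x y) (invDeg G x) (sum (λ u → A x u * probHitAt G u y k)) ⟩
      Q (λ u → probHitAt G u y k) x ∎
      where
      -- With the four tests generalised to Booleans, factoring the weight of a sequence into its
      -- first step and the rest is a finite case check.
      branch : ∀ a b w h i p → (if (a ∧ w) ∧ not b ∧ h then i * p else 0ℚ)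
        ≡ (1ℚ - (if b then 1ℚ else 0ℚ)) * (i * (if a then 1ℚ else 0ℚ)) * (if w ∧ h then p else 0ℚ)
      branch true false true true i p =
        solve 2 (λ i p → i :* p := (con 1ℚ :- con 0ℚ) :* (i :* con 1ℚ) :* p) refl i p
      branch true false true false i p = ≡-sym (*-zeroʳ ((1ℚ - 0ℚ) * (i * 1ℚ)))
      branch true false false h i p = ≡-sym (*-zeroʳ ((1ℚ - 0ℚ) * (i * 1ℚ)))
      branch true true true h i p =
        solve 2 (λ i q → con 0ℚ := (con 1ℚ :- con 1ℚ) :* (i :* con 1ℚ) :* q) refl i (if h then p else 0ℚ)
      branch true true false h i p = ≡-sym (*-zeroʳ ((1ℚ - 1ℚ) * (i * 1ℚ)))
      branch false b w h i p =
        solve 3 (λ c i q → con 0ℚ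
            := c :* (i :* con 0ℚ) :* q) refl (1ℚ - (if b then 1ℚ else 0ℚ)) i (if w ∧ h then p else 0ℚ)
      first-step : ∀ u l → probFrom y x (u ∷ l) ≡ (1ℚ - δ x y) * (invDeg G x * A x u) * probFrom y u l
      first-step u l = branch (adj G x u) (does (x ≟ y)) (isWalkB G (u ∷ l)) (firstHitAtEnd G y (u ∷ l)) (invDeg G x) (weight G (u ∷ l))

    Q-cong : ∀ {f g} → (∀ u → f u ≡ g u) → ∀ x → Q f x ≡ Q g x
    Q-cong f≗g x = cong (λ s → (1ℚ - δ x y) * (invDeg G x * s)) (sum-cong-≗ λ u → cong (A x u *_) (f≗g u))

    Q-+ : ∀ f g x → Q (λ u → f u + g u) x ≡ Q f x + Q g x
    Q-+ f g x = begin
      c * (i * sum (λ u → A x u * (f u + g u)))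
        ≡⟨ cong (λ s → c * (i * s)) (trans (sum-cong-≗ λ u → ℚₚ.*-distribˡ-+ (A x u) (f u) (g u)) (∑-distrib-+ (λ u → A x u * f u) (λ u → A x u * g u))) ⟩
      c * (i * (sum (λ u → A x u * f u) + sum (λ u → A x u * g u)))
        ≡⟨ solve 4 (λ c i s t → c :* (i :* (s :+ t))
            := c :* (i :* s) :+ c :* (i :* t)) refl c i (sum (λ u → A x u * f u)) (sum (λ u → A x u * g u)) ⟩
      Q f x + Q g x ∎
      where
      c i : ℚ
      c = 1ℚ - δ x y
      i = invDeg G x

    Q-scale : ∀ a f x → Q (λ u → a * f u) x ≡ a * Q f x
    Q-scale a f x = begin
      c * (i * sum (λ u → A x u * (a * f u)))
        ≡⟨ cong (λ s → c * (i * s)) (trans (sum-cong-≗ λ u → solve 3 (λ e a f → e :* (a :* f)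
            := a :* (e :* f)) refl (A x u) a (f u)) (≡-sym (*-distribˡ-sum a (λ u → A x u * f u)))) ⟩
      c * (i * (a * sum (λ u → A x u * f u)))
        ≡⟨ solve 4 (λ c i a s → c :* (i :* (a :* s)) := a :* (c :* (i :* s))) refl c i a (sum (λ u → A x u * f u)) ⟩
      a * Q f x ∎
      where
      c i : ℚ
      c = 1ℚ - δ x y
      i = invDeg G x

    Q-- : ∀ f g x → Q (λ u → f u - g u) x ≡ Q f x - Q g x
    Q-- f g x = begin
      Q (λ u → f u - g u) x                   ≡⟨ Q-cong (λ u → solve 2 (λ p q → p :- q
          := p :+ con (- 1ℚ) :* q) refl (f u) (g u)) x ⟩
      Q (λ u → f u + (- 1ℚ) * g u) x          ≡⟨ Q-+ f (λ u → (- 1ℚ) * g u) x ⟩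
      Q f x + Q (λ u → (- 1ℚ) * g u) x        ≡⟨ cong (Q f x +_) (Q-scale (- 1ℚ) g x) ⟩
      Q f x + (- 1ℚ) * Q g x                  ≡⟨ solve 2 (λ p q → p :+ con (- 1ℚ) :* q := p :- q) refl (Q f x) (Q g x) ⟩
      Q f x - Q g x                           ∎

    0≤1-δ : ∀ x → 0ℚ ≤ 1ℚ - δ x y
    0≤1-δ x with does (x ≟ y)
    ... | true  = ≤-refl
    ... | false = 0≤1

    0≤invDeg : ∀ x → 0ℚ ≤ invDeg G x
    0≤invDeg x with deg G x
    ... | zero  = ≤-refl
    ... | suc k = ℚₚ.nonNegative⁻¹ (ℤ.+ 1 ℚ./ suc k) {{ℚₚ.normalize-nonNeg 1 (suc k)}}

    Q-nonneg : ∀ {f} → (∀ u → 0ℚ ≤ f u) → ∀ x → 0ℚ ≤ Q f x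
    Q-nonneg {f} 0≤f x = 0≤* (0≤1-δ x) (0≤* (0≤invDeg x) (sum-nonneg (λ u → A x u * f u) λ u → 0≤* (0≤A x u) (0≤f u)))

    Q-mono : ∀ {f g} → (∀ u → f u ≤ g u) → ∀ x → Q f x ≤ Q g x
    Q-mono {f} {g} f≤g x = ≤-witness (Q g x - Q f x)
      (subst (0ℚ ≤_) (Q-- g f x) (Q-nonneg (λ u → ≤⇒0≤- (f≤g u)) x))
      (solve 2 (λ p q → q := p :+ (q :- p)) refl (Q f x) (Q g x))

    invDeg-inverse : ∀ x → deg G x ≢ 0 → invDeg G x * degree x ≡ 1ℚ
    invDeg-inverse x deg≢0 = trans (cong (invDeg G x *_) (≡-sym (fromℕ-deg x))) inverse
      where
      inverse : invDeg G x * fromℕ (deg G x) ≡ 1ℚ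
      inverse with deg G x
      ... | zero  = contradiction refl deg≢0
      ... | suc k = reciprocal k

    -- `sumBelow` splits off its last term, whereas a first-step recursion must split off term 0 and
    -- shift the others.
    sumBelow-suc : ∀ (f : ℕ → ℚ) K → sumBelow G f (suc K) ≡ f 0 + sumBelow G (f ∘ suc) K
    sumBelow-suc f zero    = ℚₚ.+-comm 0ℚ (f 0)
    sumBelow-suc f (suc K) = trans (cong (_+ f (suc K)) (sumBelow-suc f K)) (ℚₚ.+-assoc (f 0) (sumBelow G (f ∘ suc) K) (f (suc K)))

    sumBelow-cong : ∀ {f g : ℕ → ℚ} → (∀ k → f k ≡ g k) → ∀ K → sumBelow G f K ≡ sumBelow G g K
    sumBelow-cong f≗g zero    = refl
    sumBelow-cong f≗g (suc K) = cong₂ _+_ (sumBelow-cong f≗g K) (f≗g K)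

    sumBelow-Q : ∀ (f : ℕ → Fin n → ℚ) K x → sumBelow G (λ k → Q (f k) x) K ≡ Q (λ u → sumBelow G (λ k → f k u) K) x
    sumBelow-Q f zero x = ≡-sym (begin
      Q (λ _ → 0ℚ) x            ≡⟨ Q-scale 0ℚ (λ _ → 0ℚ) x ⟩
      0ℚ * Q (λ _ → 0ℚ) x       ≡⟨ *-zeroˡ (Q (λ _ → 0ℚ) x) ⟩
      0ℚ                        ∎)
    sumBelow-Q f (suc K) x = trans (cong (_+ Q (f K) x) (sumBelow-Q f K x)) (≡-sym (Q-+ (λ u → sumBelow G (λ k → f k u) K) (f K) x))

    p : ℕ → Fin n → ℚ
    p k x = probHitAt G x y k

    kp : ℕ → Fin n → ℚ
    kp k x = ℕ→ℚ k * p k x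

    -- With τ the hitting time of `y`, this is the probability of τ ≥ `K`: the sum stops just before
    -- `K`.
    survival : ℕ → Fin n → ℚ
    survival K x = 1ℚ - sumBelow G (λ k → p k x) K

  -- The Laplacian of the distance and the closed form of the hitting time

  module OnTree (tree : IsTree G) where
    open Tree tree

    D : Fin n → Fin n → ℚ
    D v w = fromℕ (dist v w)

    D-sym : ∀ v w → D v w ≡ D w v
    D-sym v w = cong fromℕ (dist-sym v w)

    D-refl : ∀ v → D v v ≡ 0ℚ
    D-refl v = trans (cong fromℕ (dist-refl v)) fromℕ-0

    neighbour-D : ∀ {v u} w → adj G v u ≡ true → D u w ≡ D v w + 1ℚ ⊎ D v w ≡ D u w + 1ℚ
    neighbour-D {v} {u} w e with neighbour-dist w e
    ... | inj₁ eq = inj₁ (trans (cong fromℕ eq) (fromℕ-suc (dist v w)))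
    ... | inj₂ eq = inj₂ (trans (cong fromℕ eq) (fromℕ-suc (dist u w)))

    lap-D : ∀ w v → lap (λ u → D u w) v ≡ 2ℚ - 2ℚ * δ v w - degree v
    lap-D w v with v ≟ w
    ... | yes refl = begin
      lap (λ u → D u v) v            ≡⟨ sum-cong-≗ pointwise ⟩
      sum (λ u → A v u * (- 1ℚ))     ≡⟨ *-distribʳ-sum (- 1ℚ) (A v) ⟨
      degree v * (- 1ℚ)              ≡⟨ solve 1 (λ d → d :* con (- 1ℚ)
          := con 2ℚ :- con 2ℚ :* con 1ℚ :- d) refl (degree v) ⟩
      2ℚ - 2ℚ * 1ℚ - degree v       ∎
      where
      pointwise : ∀ u → A v u * (D v v - D u v) ≡ A v u * (- 1ℚ)
      pointwise u = A-cong v u far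
        where
        far : adj G v u ≡ true → D v v - D u v ≡ - 1ℚ
        far e with neighbour-dist v e
        ... | inj₁ eq = trans (cong (λ t → D v v - t) (trans (cong fromℕ eq) (fromℕ-suc (dist v v))))
                              (solve 1 (λ d → d :- (d :+ con 1ℚ) := con (- 1ℚ)) refl (D v v))
        ... | inj₂ eq with trans (≡-sym (dist-refl v)) eq
        ...   | ()
    ... | no v≢w with closer-neighbour v≢w
    ...   | u₀ , e₀ , c₀ = begin
      lap (λ u → D u w) v                    ≡⟨ sum-cong-≗ pointwise ⟩
      -- Every neighbour contributes -1, except the closer one `u₀`, whose +1 is written as 2 - 1.
      sum (λ u → δ u u₀ * 2ℚ - A v u)        ≡⟨ sum-- (λ u → δ u u₀ * 2ℚ) (A v) ⟩
      sum (λ u → δ u u₀ * 2ℚ) - degree v     ≡⟨ cong (_- degree v) (sum-δ (λ _ → 2ℚ) u₀) ⟩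
      2ℚ - degree v                          ≡⟨ refl ⟩
      2ℚ - 2ℚ * 0ℚ - degree v               ∎
      where
      pointwise : ∀ u → A v u * (D v w - D u w) ≡ δ u u₀ * 2ℚ - A v u
      pointwise u with adj G v u in e
      pointwise u | false = trans (*-zeroˡ (D v w - D u w)) (≡-sym (cong (λ t → t * 2ℚ - 0ℚ) (δ-≢ u≢u₀)))
        where
        u≢u₀ : u ≢ u₀
        u≢u₀ refl with trans (≡-sym e) e₀
        ... | ()
      pointwise u | true with neighbour-dist w e
      ... | inj₁ far = begin
        1ℚ * (D v w - D u w)              ≡⟨ cong (λ t → 1ℚ * (D v w - t)) (trans (cong fromℕ far) (fromℕ-suc (dist v w))) ⟩
        1ℚ * (D v w - (D v w + 1ℚ))      ≡⟨ solve 1 (λ d → con 1ℚ :* (d :- (d :+ con 1ℚ))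
            := con (0ℚ * 2ℚ - 1ℚ)) refl (D v w) ⟩
        0ℚ * 2ℚ - 1ℚ                     ≡⟨ cong (λ t → t * 2ℚ - 1ℚ) (δ-≢ u≢u₀) ⟨
        δ u u₀ * 2ℚ - 1ℚ                 ∎
        where
        u≢u₀ : u ≢ u₀
        u≢u₀ refl = ℕₚ.<-asym (ℕₚ.≤-reflexive (≡-sym far)) (ℕₚ.≤-reflexive (≡-sym c₀))
      ... | inj₂ near = begin
        1ℚ * (D v w - D u w)              ≡⟨ cong (λ t → 1ℚ * (t - D u w)) (trans (cong fromℕ near) (fromℕ-suc (dist u w))) ⟩
        1ℚ * (D u w + 1ℚ - D u w)        ≡⟨ solve 1 (λ d → con 1ℚ :* (d :+ con 1ℚ :- d)
            := con (1ℚ * 2ℚ - 1ℚ)) refl (D u w) ⟩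
        1ℚ * 2ℚ - 1ℚ                     ≡⟨ cong (λ t → t * 2ℚ - 1ℚ) (trans (cong (δ u) (closer-neighbour-unique e₀ e c₀ near)) (δ-refl u)) ⟨
        δ u u₀ * 2ℚ - 1ℚ                 ∎

    -- Twice the Gromov product of x and w based at y, that is, twice the number of
    -- edges shared by the paths from x to y and from w to y.
    gromov : Fin n → Fin n → Fin n → ℚ
    gromov x y w = D x y + (D w y - D w x)

    -- The walk from x killed at y visits w on average degree w * gromov x y w / 2 times.
    hit : Fin n → Fin n → ℚ
    hit x y = ½ * sum (λ w → degree w * gromov x y w)

    lap-D-D : ∀ x y v → lap (λ u → D u y - D u x) v ≡ 2ℚ * δ v x - 2ℚ * δ v y
    lap-D-D x y v = begin
      lap (λ u → D u y - D u x) v                      ≡⟨ lap-- (λ u → D u y) (λ u → D u x) v ⟩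
      lap (λ u → D u y) v - lap (λ u → D u x) v        ≡⟨ cong₂ _-_ (lap-D y v) (lap-D x v) ⟩
      (2ℚ - 2ℚ * δ v y - degree v) - (2ℚ - 2ℚ * δ v x - degree v)
        ≡⟨ solve 3 (λ p q d → (con 2ℚ :- con 2ℚ :* p :- d) :- (con 2ℚ :- con 2ℚ :* q :- d)
            := con 2ℚ :* q :- con 2ℚ :* p) refl (δ v y) (δ v x) (degree v) ⟩
      2ℚ * δ v x - 2ℚ * δ v y                          ∎

    lap-gromov : ∀ x y w → lap (gromov x y) w ≡ 2ℚ * δ w x - 2ℚ * δ w y
    lap-gromov x y w = trans (lap-+const (D x y) (λ u → D u y - D u x) w) (lap-D-D x y w)

    gromov-source : ∀ x y → gromov x y x ≡ 2ℚ * D x y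
    gromov-source x y = trans (cong (λ t → D x y + (D x y - t)) (D-refl x))
      (solve 1 (λ d → d :+ (d :- con 0ℚ) := con 2ℚ :* d) refl (D x y))

    gromov-target : ∀ x y → gromov x y y ≡ 0ℚ
    gromov-target x y = trans (cong₂ (λ s t → D x y + (s - t)) (D-refl y) (D-sym y x))
      (solve 1 (λ d → d :+ (con 0ℚ :- d) := con 0ℚ) refl (D x y))

    0≤gromov : ∀ x y w → 0ℚ ≤ gromov x y w
    0≤gromov x y w = subst (0ℚ ≤_) (ℚₚ.+-assoc (D x y) (D w y) (- D w x))
      (≤⇒0≤- (subst (D w x ≤_) (trans (fromℕ-+ (dist w y) (dist y x)) (trans (ℚₚ.+-comm (D w y) (D y x)) (cong (_+ D w y) (D-sym y x))))
        (fromℕ-mono-≤ (dist-triangle w y x))))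

    hit-target : ∀ y → hit y y ≡ 0ℚ
    hit-target y = trans (cong (½ *_) (sum-0 _ λ w → trans (cong (degree w *_) (vanishes w)) (*-zeroʳ (degree w)))) (*-zeroʳ ½)
      where
      vanishes : ∀ w → gromov y y w ≡ 0ℚ
      vanishes w = trans (cong (_+ (D w y - D w y)) (D-refl y)) (solve 1 (λ d → con 0ℚ :+ (d :- d)
          := con 0ℚ) refl (D w y))

    -- The Gromov product is symmetric in its source and its last argument, so for fixed `w` it has,
    -- as a function of the source, Laplacian `2δ(v,w) − 2δ(v,y)` at `v`. Off `y` the second term
    -- vanishes, and the degree-weighted sum over `w` picks out `w = v`.
    lap-hit : ∀ {y v} → v ≢ y → lap (λ u → hit u y) v ≡ degree v
    lap-hit {y} {v} v≢y = begin
      sum (λ u → A v u * (hit v y - hit u y))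
        ≡⟨ sum-cong-≗ expand ⟩
      sum (λ u → sum (λ w → ½ * degree w * (A v u * (g w v - g w u))))
        ≡⟨ ∑-comm (λ u w → ½ * degree w * (A v u * (g w v - g w u))) ⟩
      sum (λ w → sum (λ u → ½ * degree w * (A v u * (g w v - g w u))))
        ≡⟨ sum-cong-≗ inner ⟩
      sum (λ w → δ w v * degree w)
        ≡⟨ sum-δ degree v ⟩
      degree v ∎
      where
      g : Fin n → Fin n → ℚ
      g w u = D u y - D u w
      expand : ∀ u → A v u * (hit v y - hit u y) ≡ sum (λ w → ½ * degree w * (A v u * (g w v - g w u)))
      expand u = begin
        A v u * (½ * sum F - ½ * sum F′)
          ≡⟨ solve 4 (λ a h s t → a :* (h :* s :- h :* t) := a :* h :* (s :- t)) refl (A v u) ½ (sum F) (sum F′) ⟩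
        A v u * ½ * (sum F - sum F′)
          ≡⟨ cong (A v u * ½ *_) (sum-- F F′) ⟨
        A v u * ½ * sum (λ w → F w - F′ w)
          ≡⟨ *-distribˡ-sum (A v u * ½) (λ w → F w - F′ w) ⟩
        sum (λ w → A v u * ½ * (F w - F′ w))
          ≡⟨ sum-cong-≗ (λ w → trans
               (cong₂ (λ s t → A v u * ½ * (degree w * (D v y + (D w y - s)) - degree w * (D u y + (D w y - t)))) (D-sym w v) (D-sym w u))
               (solve 8 (λ a h g p q r s t → a :* h :* (g :* (p :+ (q :- s)) :- g :* (r :+ (q :- t)))
                   := h :* g :* (a :* (p :- s :- (r :- t))))
                 refl (A v u) ½ (degree w) (D v y) (D w y) (D u y) (D v w) (D u w))) ⟩
        sum (λ w → ½ * degree w * (A v u * (g w v - g w u))) ∎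
        where
        F F′ : Fin n → ℚ
        F  w = degree w * gromov v y w
        F′ w = degree w * gromov u y w
      inner : ∀ w → sum (λ u → ½ * degree w * (A v u * (g w v - g w u))) ≡ δ w v * degree w
      inner w = begin
        sum (λ u → ½ * degree w * (A v u * (g w v - g w u)))
          ≡⟨ *-distribˡ-sum (½ * degree w) (λ u → A v u * (g w v - g w u)) ⟨
        ½ * degree w * lap (g w) v
          ≡⟨ cong (½ * degree w *_) (lap-D-D w y v) ⟩
        ½ * degree w * (2ℚ * δ v w - 2ℚ * δ v y)
          ≡⟨ cong₂ (λ s t → ½ * degree w * (2ℚ * s - 2ℚ * t)) (δ-sym v w) (δ-≢ v≢y) ⟩
        ½ * degree w * (2ℚ * δ w v - 2ℚ * 0ℚ)
          ≡⟨ solve 2 (λ d e → con ½ :* d :* (con 2ℚ :* e :- con 2ℚ :* con 0ℚ) := e :* d) refl (degree w) (δ w v) ⟩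
        δ w v * degree w ∎

    -- The lower bound as a sum of nonnegative edge terms

    slack : Fin n → Fin n → Fin n → Fin n → ℚ
    slack x y w u = A w u * ((a w + a u) * (4ℚ - (a w - a u) * (a w - a u)))
      where
      a : Fin n → ℚ
      a = gromov x y

    slacks : Fin n → Fin n → ℚ
    slacks x y = sum (λ w → sum (slack x y w))

    -- The 16 collects the factor 2 of `symmetrise`, the 4 in the slack and the ½ in `hit`; the same
    -- 16 appears on d² because a(x) = 2d.
    16⁻¹ : ℚ
    16⁻¹ = ½ * ½ * ½ * ½

    -- Summation by parts for a² against the Laplacian of a, where a = gromov x y:
    -- since Δa = 2 (δ_x − δ_y), the quadratic part of the slacks adds up to 16 d(x,y)².
    hit-slacks : ∀ x y → hit x y ≡ D x y * D x y + 16⁻¹ * slacks x y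
    hit-slacks x y = ≡-sym (begin
      d * d + 16⁻¹ * slacks x y
        ≡⟨ cong (λ s → d * d + 16⁻¹ * s) (trans (sum-cong-≗ λ w → sum-cong-≗ λ u → cong (A w u *_) (parts (a w) (a u))) (symmetrise f)) ⟩
      d * d + 16⁻¹ * (2ℚ * sum (λ w → sum (λ u → A w u * f w u)))
        ≡⟨ cong (λ s → d * d + 16⁻¹ * (2ℚ * s)) (trans (sum-cong-≗ inner) outer) ⟩
      d * d + 16⁻¹ * (2ℚ * (4ℚ * H - (2ℚ * (a x * a x) - 2ℚ * (a y * a y))))
        ≡⟨ cong₂ (λ p q → d * d + 16⁻¹ * (2ℚ * (4ℚ * H - (2ℚ * (p * p) - 2ℚ * (q * q))))) (gromov-source x y) (gromov-target x y) ⟩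
      d * d + 16⁻¹ * (2ℚ * (4ℚ * H - (2ℚ * ((2ℚ * d) * (2ℚ * d)) - 2ℚ * (0ℚ * 0ℚ))))
        ≡⟨ solve 2 (λ d h → d :* d :+ con 16⁻¹ :* (con 2ℚ :* (con 4ℚ :* h :- (con 2ℚ :* ((con 2ℚ :* d) :* (con 2ℚ :* d)) :- con 2ℚ :* (con 0ℚ :* con 0ℚ))))
            := con ½ :* h) refl d H ⟩
      hit x y ∎)
      where
      a : Fin n → ℚ
      a = gromov x y
      d H : ℚ
      d = D x y
      H = sum (λ w → degree w * a w)
      f : Fin n → Fin n → ℚ
      f w u = 4ℚ * a w - a w * a w * (a w - a u)
      -- The cubic part is `(p² − q²)(p − q)`, which splits into `p²(p − q)` and `q²(q − p)`. These
      -- are mirror images, as `symmetrise` requires.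
      parts : ∀ p q → (p + q) * (4ℚ - (p - q) * (p - q)) ≡ 4ℚ * p - p * p * (p - q) + (4ℚ * q - q * q * (q - p))
      parts = solve 2 (λ p q → (p :+ q) :* (con 4ℚ :- (p :- q) :* (p :- q))
          := con 4ℚ :* p :- p :* p :* (p :- q) :+ (con 4ℚ :* q :- q :* q :* (q :- p))) refl
      inner : ∀ w → sum (λ u → A w u * f w u) ≡ 4ℚ * (degree w * a w) - (2ℚ * (δ w x * (a w * a w)) - 2ℚ * (δ w y * (a w * a w)))
      inner w = begin
        sum (λ u → A w u * f w u)
          ≡⟨ sum-cong-≗ (λ u → solve 3 (λ e p q → e :* (con 4ℚ :* p :- p :* p :* (p :- q))
              := e :* (con 4ℚ :* p) :- p :* p :* (e :* (p :- q))) refl (A w u) (a w) (a u)) ⟩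
        sum (λ u → A w u * (4ℚ * a w) - a w * a w * (A w u * (a w - a u)))
          ≡⟨ sum-- (λ u → A w u * (4ℚ * a w)) (λ u → a w * a w * (A w u * (a w - a u))) ⟩
        sum (λ u → A w u * (4ℚ * a w)) - sum (λ u → a w * a w * (A w u * (a w - a u)))
          ≡⟨ cong₂ _-_ (*-distribʳ-sum (4ℚ * a w) (A w)) (*-distribˡ-sum (a w * a w) (λ u → A w u * (a w - a u))) ⟨
        degree w * (4ℚ * a w) - a w * a w * lap a w
          ≡⟨ cong (λ t → degree w * (4ℚ * a w) - a w * a w * t) (lap-gromov x y w) ⟩
        degree w * (4ℚ * a w) - a w * a w * (2ℚ * δ w x - 2ℚ * δ w y)
          ≡⟨ solve 4 (λ g p s t → g :* (con 4ℚ :* p) :- p :* p :* (con 2ℚ :* s :- con 2ℚ :* t)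
              := con 4ℚ :* (g :* p) :- (con 2ℚ :* (s :* (p :* p)) :- con 2ℚ :* (t :* (p :* p))))
              refl (degree w) (a w) (δ w x) (δ w y) ⟩
        4ℚ * (degree w * a w) - (2ℚ * (δ w x * (a w * a w)) - 2ℚ * (δ w y * (a w * a w))) ∎
      outer : sum (λ w → 4ℚ * (degree w * a w) - (2ℚ * (δ w x * (a w * a w)) - 2ℚ * (δ w y * (a w * a w))))
              ≡ 4ℚ * H - (2ℚ * (a x * a x) - 2ℚ * (a y * a y))
      outer = begin
        sum (λ w → 4ℚ * (degree w * a w) - (2ℚ * (δ w x * (a w * a w)) - 2ℚ * (δ w y * (a w * a w))))
          ≡⟨ sum-- (λ w → 4ℚ * (degree w * a w)) (λ w → 2ℚ * (δ w x * (a w * a w)) - 2ℚ * (δ w y * (a w * a w))) ⟩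
        sum (λ w → 4ℚ * (degree w * a w)) - sum (λ w → 2ℚ * (δ w x * (a w * a w)) - 2ℚ * (δ w y * (a w * a w)))
          ≡⟨ cong₂ _-_ (≡-sym (*-distribˡ-sum 4ℚ (λ w → degree w * a w))) (sum-- (λ w → 2ℚ * (δ w x * (a w * a w))) (λ w → 2ℚ * (δ w y * (a w * a w)))) ⟩
        4ℚ * H - (sum (λ w → 2ℚ * (δ w x * (a w * a w))) - sum (λ w → 2ℚ * (δ w y * (a w * a w))))
          ≡⟨ cong₂ (λ s t → 4ℚ * H - (s - t)) (at x) (at y) ⟩
        4ℚ * H - (2ℚ * (a x * a x) - 2ℚ * (a y * a y)) ∎
        where
        at : ∀ z → sum (λ w → 2ℚ * (δ w z * (a w * a w))) ≡ 2ℚ * (a z * a z)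
        at z = trans (≡-sym (*-distribˡ-sum 2ℚ (λ w → δ w z * (a w * a w)))) (cong (2ℚ *_) (sum-δ (λ w → a w * a w) z))

    -- For every `w` the two Gromov products, based at `y` and at `x`, add up to `2 d(x,y)`: each
    -- edge of the path from `x` to `y` is counted by exactly one of them. The degrees then add up
    -- to 2m.
    commute-time : ∀ x y → hit x y + hit y x ≡ fromℕ (2 ℕ.* edges G) * D x y
    commute-time x y = begin
      ½ * sum F + ½ * sum F′           ≡⟨ ℚₚ.*-distribˡ-+ ½ (sum F) (sum F′) ⟨
      ½ * (sum F + sum F′)             ≡⟨ cong (½ *_) (∑-distrib-+ F F′) ⟨
      ½ * sum (λ w → F w + F′ w)       ≡⟨ cong (½ *_) (sum-cong-≗ pointwise) ⟩
      ½ * sum (λ w → degree w * (2ℚ * D x y))  ≡⟨ cong (½ *_) (*-distribʳ-sum (2ℚ * D x y) degree) ⟨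
      ½ * (sum degree * (2ℚ * D x y))  ≡⟨ solve 2 (λ s d → con ½ :* (s :* (con 2ℚ :* d))
          := s :* d) refl (sum degree) (D x y) ⟩
      sum degree * D x y               ≡⟨ cong (_* D x y) handshake ⟩
      fromℕ (2 ℕ.* edges G) * D x y    ∎
      where
      F F′ : Fin n → ℚ
      F  w = degree w * gromov x y w
      F′ w = degree w * gromov y x w
      pointwise : ∀ w → F w + F′ w ≡ degree w * (2ℚ * D x y)
      pointwise w = trans (cong (λ t → F w + degree w * (t + (D w x - D w y))) (D-sym y x))
        (solve 4 (λ g d p q → g :* (d :+ (p :- q)) :+ g :* (d :+ (q :- p))
            := g :* (con 2ℚ :* d)) refl (degree w) (D x y) (D w y) (D w x))

    -- Both distances change by one along an edge. Changes in the same direction cancel in the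
    -- difference, and opposite changes add up to 2.
    gromov-adj : ∀ x y {w u} → adj G w u ≡ true →
      gromov x y u ≡ gromov x y w ⊎ (gromov x y u ≡ gromov x y w + 2ℚ ⊎ gromov x y w ≡ gromov x y u + 2ℚ)
    gromov-adj x y {w} {u} e with neighbour-D y e | neighbour-D x e
    ... | inj₁ p | inj₁ q = inj₁ (trans (cong₂ (λ s t → D x y + (s - t)) p q)
      (solve 3 (λ d s t → d :+ (s :+ con 1ℚ :- (t :+ con 1ℚ)) := d :+ (s :- t)) refl (D x y) (D w y) (D w x)))
    ... | inj₂ p | inj₂ q = inj₁ (≡-sym (trans (cong₂ (λ s t → D x y + (s - t)) p q)
      (solve 3 (λ d s t → d :+ (s :+ con 1ℚ :- (t :+ con 1ℚ)) := d :+ (s :- t)) refl (D x y) (D u y) (D u x))))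
    ... | inj₁ p | inj₂ q = inj₂ (inj₁ (trans (cong (λ s → D x y + (s - D u x)) p) (trans
      (solve 3 (λ d s t → d :+ (s :+ con 1ℚ :- t) := d :+ (s :- (t :+ con 1ℚ)) :+ con 2ℚ) refl (D x y) (D w y) (D u x))
      (cong (λ t → D x y + (D w y - t) + 2ℚ) (≡-sym q)))))
    ... | inj₂ p | inj₁ q = inj₂ (inj₂ (trans (cong (λ s → D x y + (s - D w x)) p) (trans
      (solve 3 (λ d s t → d :+ (s :+ con 1ℚ :- t) := d :+ (s :- (t :+ con 1ℚ)) :+ con 2ℚ) refl (D x y) (D u y) (D w x))
      (cong (λ t → D x y + (D u y - t) + 2ℚ) (≡-sym q)))))

    slack-flat : ∀ x y {w u} → adj G w u ≡ true → gromov x y u ≡ gromov x y w →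
                 slack x y w u ≡ 4ℚ * (2ℚ * gromov x y w)
    slack-flat x y {w} e eq = trans
      (cong₂ (λ k p → k * ((gromov x y w + p) * (4ℚ - (gromov x y w - p) * (gromov x y w - p)))) (A-adj e) eq)
      (solve 1 (λ p → con 1ℚ :* ((p :+ p) :* (con 4ℚ :- (p :- p) :* (p :- p)))
          := con 4ℚ :* (con 2ℚ :* p)) refl (gromov x y w))

    slack-steep : ∀ x y w u → gromov x y u ≡ gromov x y w + 2ℚ ⊎ gromov x y w ≡ gromov x y u + 2ℚ →
                  slack x y w u ≡ 0ℚ
    slack-steep x y w u (inj₁ eq) = trans
      (cong (λ p → A w u * ((gromov x y w + p) * (4ℚ - (gromov x y w - p) * (gromov x y w - p)))) eq)
      (solve 2 (λ k p → k :* ((p :+ (p :+ con 2ℚ)) :* (con 4ℚ :- (p :- (p :+ con 2ℚ)) :* (p :- (p :+ con 2ℚ))))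
          := con 0ℚ) refl (A w u) (gromov x y w))
    slack-steep x y w u (inj₂ eq) = trans
      (cong (λ p → A w u * ((p + gromov x y u) * (4ℚ - (p - gromov x y u) * (p - gromov x y u)))) eq)
      (solve 2 (λ k p → k :* ((p :+ con 2ℚ :+ p) :* (con 4ℚ :- (p :+ con 2ℚ :- p) :* (p :+ con 2ℚ :- p)))
          := con 0ℚ) refl (A w u) (gromov x y u))

    slack-nonadj : ∀ x y {w u} → adj G w u ≡ false → slack x y w u ≡ 0ℚ
    slack-nonadj x y {w} {u} e = trans (cong (_* c) (A-nonadj e)) (*-zeroˡ c)
      where
      c : ℚ
      c = (gromov x y w + gromov x y u) * (4ℚ - (gromov x y w - gromov x y u) * (gromov x y w - gromov x y u))

    0≤4*2* : ∀ {p} → 0ℚ ≤ p → 0ℚ ≤ 4ℚ * (2ℚ * p)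
    0≤4*2* 0≤p = 0≤* (0≤+ 0≤2 0≤2) (0≤* 0≤2 0≤p)
      where
      0≤2 : 0ℚ ≤ 2ℚ
      0≤2 = 0≤+ 0≤1 0≤1

    adjacent? : ∀ w u → adj G w u ≡ true ⊎ adj G w u ≡ false
    adjacent? w u with adj G w u
    ... | true  = inj₁ refl
    ... | false = inj₂ refl

    0≤slack : ∀ x y w u → 0ℚ ≤ slack x y w u
    0≤slack x y w u with adjacent? w u
    ... | inj₂ e = ℚₚ.≤-reflexive (≡-sym (slack-nonadj x y e))
    ... | inj₁ e with gromov-adj x y e
    ...   | inj₁ flat  = subst (0ℚ ≤_) (≡-sym (slack-flat x y e flat)) (0≤4*2* (0≤gromov x y w))
    ...   | inj₂ steep = ℚₚ.≤-reflexive (≡-sym (slack-steep x y w u steep))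

    0≤slacks : ∀ x y → 0ℚ ≤ slacks x y
    0≤slacks x y = sum-nonneg (λ w → sum (slack x y w)) λ w → sum-nonneg (slack x y w) (0≤slack x y w)

    D²≤hit : ∀ x y → D x y * D x y ≤ hit x y
    D²≤hit x y = ≤-witness (16⁻¹ * slacks x y) (0≤* (ℚₚ.nonNegative⁻¹ 16⁻¹) (0≤slacks x y)) (hit-slacks x y)

    -- Equality in the lower bound

    geodesic⇒gromov : ∀ {x y w} → dist x w ℕ.+ dist w y ≡ dist x y → gromov x y w ≡ 2ℚ * D w y
    geodesic⇒gromov {x} {y} {w} eq = begin
      D x y + (D w y - D w x)
        ≡⟨ cong₂ (λ s t → s + (D w y - t)) (trans (cong fromℕ (≡-sym eq)) (fromℕ-+ (dist x w) (dist w y))) (D-sym w x) ⟩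
      D x w + D w y + (D w y - D x w)
        ≡⟨ solve 2 (λ s t → s :+ t :+ (t :- s) := con 2ℚ :* t) refl (D x w) (D w y) ⟩
      2ℚ * D w y ∎

    beyond⇒gromov : ∀ {x y w} → dist w y ℕ.+ dist y x ≡ dist w x → gromov x y w ≡ 0ℚ
    beyond⇒gromov {x} {y} {w} eq = begin
      D x y + (D w y - D w x)
        ≡⟨ cong₂ (λ s t → s + (D w y - t)) (D-sym x y) (trans (cong fromℕ (≡-sym eq)) (fromℕ-+ (dist w y) (dist y x))) ⟩
      D y x + (D w y - (D w y + D y x))
        ≡⟨ solve 2 (λ s t → s :+ (t :- (t :+ s)) := con 0ℚ) refl (D y x) (D w y) ⟩
      0ℚ ∎

    gromov⇒beyond : ∀ {x y w} → gromov x y w ≡ 0ℚ → dist w y ℕ.+ dist y x ≡ dist w x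
    gromov⇒beyond {x} {y} {w} eq = fromℕ-injective (begin
      fromℕ (dist w y ℕ.+ dist y x)
        ≡⟨ fromℕ-+ (dist w y) (dist y x) ⟩
      D w y + D y x
        ≡⟨ cong (D w y +_) (D-sym y x) ⟩
      D w y + D x y
        ≡⟨ solve 3 (λ d s t → s :+ d := d :+ (s :- t) :+ t) refl (D x y) (D w y) (D w x) ⟩
      gromov x y w + D w x
        ≡⟨ trans (cong (_+ D w x) eq) (ℚₚ.+-identityˡ (D w x)) ⟩
      D w x ∎)

    neighbour-dist-≢ : ∀ {v u} w → adj G v u ≡ true → dist u w ≢ dist v w
    neighbour-dist-≢ w e same with neighbour-dist w e
    ... | inj₁ far  = ℕₚ.1+n≢n (trans (≡-sym far) same)
    ... | inj₂ near = ℕₚ.1+n≢n (trans (≡-sym near) (≡-sym same))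

    Extremal : Fin n → Fin n → Set
    Extremal x y = ∀ w → OnPath G w x y ⊎ OnPath G y w x

    -- Only flat edges matter. If either end lies beyond `y`, the Gromov product is 0 there and, by
    -- flatness, at both ends. Two ends on the path are impossible: there the product is `2 d(·,y)`,
    -- which changes along every edge.
    extremal⇒slack≡0 : ∀ {x y} → Extremal x y → ∀ w u → slack x y w u ≡ 0ℚ
    extremal⇒slack≡0 {x} {y} ext w u with adjacent? w u
    ... | inj₂ e = slack-nonadj x y e
    ... | inj₁ e with gromov-adj x y e
    ...   | inj₂ steep = slack-steep x y w u steep
    ...   | inj₁ flat = trans (slack-flat x y e flat) (cong (λ p → 4ℚ * (2ℚ * p)) (vanishes (ext w) (ext u)))
      where
      vanishes : OnPath G w x y ⊎ OnPath G y w x → OnPath G u x y ⊎ OnPath G y u x → gromov x y w ≡ 0ℚ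
      vanishes (inj₂ b) _ = beyond⇒gromov (onPath⇒dist b)
      vanishes (inj₁ _) (inj₂ b) = trans (≡-sym flat) (beyond⇒gromov (onPath⇒dist b))
      vanishes (inj₁ p) (inj₁ q) = contradiction same-dist (neighbour-dist-≢ y e)
        where
        half : ∀ d → ½ * (2ℚ * d) ≡ d
        half = solve 1 (λ d → con ½ :* (con 2ℚ :* d) := d) refl
        same-dist : dist u y ≡ dist w y
        same-dist = fromℕ-injective (begin
          D u y               ≡⟨ half (D u y) ⟨
          ½ * (2ℚ * D u y)    ≡⟨ cong (½ *_) (geodesic⇒gromov (onPath⇒dist q)) ⟨
          ½ * gromov x y u    ≡⟨ cong (½ *_) flat ⟩
          ½ * gromov x y w    ≡⟨ cong (½ *_) (geodesic⇒gromov (onPath⇒dist p)) ⟩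
          ½ * (2ℚ * D w y)    ≡⟨ half (D w y) ⟩
          D w y               ∎)

    -- Induction on the distance to `x`, comparing `w` with its neighbour `u` one step closer to
    -- `x`. What decides is whether that step also approaches `y`.
    slack≡0⇒extremal : ∀ {x y} → (∀ w u → slack x y w u ≡ 0ℚ) → Extremal x y
    slack≡0⇒extremal {x} {y} tight w = on-path (dist w x) w refl
      where
      on-path : ∀ k w → dist w x ≡ k → OnPath G w x y ⊎ OnPath G y w x
      on-path zero w eq with dist≡0⇒≡ eq
      ... | refl = inj₁ (dist⇒onPath (cong (ℕ._+ dist x y) (dist-refl x)))
      on-path (suc k) w eq with closer-neighbour {w} {x} w≢x
        where
        w≢x : w ≢ x
        w≢x refl with trans (≡-sym eq) (dist-refl x)
        ... | ()
      ... | u , e , c with neighbour-dist y e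
      -- Moving closer to both `x` and `y` makes the edge flat, so its vanishing slack `8 a(w)`
      -- forces `a(w) = 0`.
      ...   | inj₂ near = inj₂ (dist⇒onPath (gromov⇒beyond (begin
        gromov x y w                             ≡⟨ solve 1 (λ p → p
            := con (½ * ½ * ½) :* (con 4ℚ :* (con 2ℚ :* p))) refl (gromov x y w) ⟩
        ½ * ½ * ½ * (4ℚ * (2ℚ * gromov x y w))   ≡⟨ cong (½ * ½ * ½ *_) (trans (≡-sym (slack-flat x y e flat)) (tight w u)) ⟩
        ½ * ½ * ½ * 0ℚ                          ≡⟨⟩
        0ℚ                                      ∎)))
        where
        succ : ∀ {i j} → i ≡ suc j → fromℕ i ≡ fromℕ j + 1ℚ
        succ {j = j} eq = trans (cong fromℕ eq) (fromℕ-suc j)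
        flat : gromov x y u ≡ gromov x y w
        flat = ≡-sym (trans (cong₂ (λ s t → D x y + (s - t)) (succ near) (succ c))
          (solve 3 (λ d s t → d :+ (s :+ con 1ℚ :- (t :+ con 1ℚ)) := d :+ (s :- t)) refl (D x y) (D u y) (D u x)))
      ...   | inj₁ far with on-path k u (ℕₚ.suc-injective (trans (≡-sym c) eq))
      ...     | inj₁ p = inj₁ (dist⇒onPath (begin
        dist x w ℕ.+ dist w y          ≡⟨ cong (ℕ._+ dist w y) (trans (dist-sym x w) (trans c (cong suc (dist-sym u x)))) ⟩
        suc (dist x u) ℕ.+ dist w y    ≡⟨ ℕₚ.+-suc (dist x u) (dist w y) ⟨
        dist x u ℕ.+ suc (dist w y)    ≡⟨ cong (dist x u ℕ.+_) far ⟨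
        dist x u ℕ.+ dist u y          ≡⟨ onPath⇒dist p ⟩
        dist x y                       ∎))
      -- If `u` were beyond `y`, going through `y` would bring `w` at least as close to `x` as `u`,
      -- although `w` is one step farther.
      ...     | inj₂ b = contradiction overshoot (ℕₚ.<⇒≱ (ℕₚ.n<1+n (dist u x)))
        where
        overshoot : suc (dist u x) ℕ.≤ dist u x
        overshoot = ℕₚ.≤-trans (ℕₚ.≤-reflexive (≡-sym c)) (ℕₚ.≤-trans (dist-triangle w y x)
          (ℕₚ.≤-trans (ℕₚ.+-monoˡ-≤ (dist y x) (ℕₚ.n≤1+n (dist w y)))
            (ℕₚ.≤-reflexive (trans (cong (ℕ._+ dist y x) (≡-sym far)) (onPath⇒dist b)))))

    hit≡D²⇔extremal : ∀ x y → (hit x y ≡ D x y * D x y) ⇔ Extremal x y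
    hit≡D²⇔extremal x y = mk⇔ to from
      where
      to : hit x y ≡ D x y * D x y → Extremal x y
      to eq = slack≡0⇒extremal λ w → sum-nonneg≡0 (slack x y w) (0≤slack x y w)
        (sum-nonneg≡0 (λ w → sum (slack x y w)) (λ w → sum-nonneg (slack x y w) (0≤slack x y w)) total w)
        where
        16ℚ : ℚ
        16ℚ = 4ℚ * 4ℚ
        total : slacks x y ≡ 0ℚ
        total = begin
          slacks x y
            ≡⟨ solve 2 (λ s d → s := con 16ℚ :* (d :+ con 16⁻¹ :* s :- d)) refl (slacks x y) (D x y * D x y) ⟩
          16ℚ * (D x y * D x y + 16⁻¹ * slacks x y - D x y * D x y)
            ≡⟨ cong (λ h → 16ℚ * (h - D x y * D x y)) (trans (≡-sym (hit-slacks x y)) eq) ⟩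
          16ℚ * (D x y * D x y - D x y * D x y)
            ≡⟨ solve 1 (λ d → con 16ℚ :* (d :- d) := con 0ℚ) refl (D x y * D x y) ⟩
          0ℚ ∎
      from : Extremal x y → hit x y ≡ D x y * D x y
      from ext = begin
        hit x y                                ≡⟨ hit-slacks x y ⟩
        D x y * D x y + 16⁻¹ * slacks x y      ≡⟨ cong (λ s → D x y * D x y + 16⁻¹ * s) (sum-0 (λ w → sum (slack x y w)) λ w → sum-0 (slack x y w) (extremal⇒slack≡0 ext w)) ⟩
        D x y * D x y + 16⁻¹ * 0ℚ              ≡⟨ ℚₚ.+-identityʳ (D x y * D x y) ⟩
        D x y * D x y                          ∎

    -- The upper bound and its equality case by reversing the roles of x and y

    lower-value : ∀ x y → D x y * D x y ≡ ℕ→ℚ (dist x y ℕ.* dist x y)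
    lower-value x y = trans (≡-sym (fromℕ-* (dist x y) (dist x y))) (fromℕ-def (dist x y ℕ.* dist x y))

    -- d ≤ 2m, needed for the truncated subtraction, follows from the commute
    -- time 2md being at least the sum 2d² of the two lower bounds.
    upper-value : ∀ x y → fromℕ (2 ℕ.* edges G) * D x y - D x y * D x y
                        ≡ ℕ→ℚ (dist x y ℕ.* (2 ℕ.* edges G ℕ.∸ dist x y))
    upper-value x y = trans (begin
        M * D x y - D x y * D x y
          ≡⟨ cong₂ _-_ (trans (ℚₚ.*-comm M (D x y)) (≡-sym (fromℕ-* d m))) (≡-sym (fromℕ-* d d)) ⟩
        fromℕ (d ℕ.* m) - fromℕ (d ℕ.* d)
          ≡⟨ cong (λ k → fromℕ k - fromℕ (d ℕ.* d)) (≡-sym (ℕₚ.m∸n+n≡m d*d≤d*m)) ⟩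
        fromℕ (d ℕ.* m ℕ.∸ d ℕ.* d ℕ.+ d ℕ.* d) - fromℕ (d ℕ.* d)
          ≡⟨ cong (_- fromℕ (d ℕ.* d)) (fromℕ-+ (d ℕ.* m ℕ.∸ d ℕ.* d) (d ℕ.* d)) ⟩
        fromℕ (d ℕ.* m ℕ.∸ d ℕ.* d) + fromℕ (d ℕ.* d) - fromℕ (d ℕ.* d)
          ≡⟨ solve 2 (λ p q → p :+ q :- q := p) refl (fromℕ (d ℕ.* m ℕ.∸ d ℕ.* d)) (fromℕ (d ℕ.* d)) ⟩
        fromℕ (d ℕ.* m ℕ.∸ d ℕ.* d)
          ≡⟨ cong fromℕ (ℕₚ.*-distribˡ-∸ d m d) ⟨
        fromℕ (d ℕ.* (m ℕ.∸ d)) ∎)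
      (fromℕ-def (d ℕ.* (m ℕ.∸ d)))
      where
      d m : ℕ
      d = dist x y
      m = 2 ℕ.* edges G
      M : ℚ
      M = fromℕ m
      d*d≤d*m : d ℕ.* d ℕ.≤ d ℕ.* m
      d*d≤d*m = fromℕ-cancel-≤ (subst₂ _≤_ (≡-sym (fromℕ-* d d))
        (trans (commute-time x y) (trans (ℚₚ.*-comm M (D x y)) (≡-sym (fromℕ-* d m))))
        (ℚₚ.≤-trans (D²≤hit x y) (≤-witness (hit y x) 0≤hit-yx refl)))
        where
        0≤hit-yx : 0ℚ ≤ hit y x
        0≤hit-yx = ℚₚ.≤-trans (0≤* (0≤fromℕ (dist y x)) (0≤fromℕ (dist y x))) (D²≤hit y x)

    hit-via-commute : ∀ x y → hit x y ≡ fromℕ (2 ℕ.* edges G) * D x y - hit y x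
    hit-via-commute x y = trans
      (solve 2 (λ p q → p := p :+ q :- q) refl (hit x y) (hit y x))
      (cong (_- hit y x) (commute-time x y))

    hit≤ : ∀ x y → hit x y ≤ fromℕ (2 ℕ.* edges G) * D x y - D x y * D x y
    hit≤ x y = ≤-witness (hit y x - D y x * D y x) (≤⇒0≤- (D²≤hit y x)) (begin
      M * D x y - D x y * D x y
        ≡⟨ cong (λ t → M * D x y - t * t) (D-sym x y) ⟩
      M * D x y - D y x * D y x
        ≡⟨ solve 3 (λ p h s → p :- s := p :- h :+ (h :- s)) refl (M * D x y) (hit y x) (D y x * D y x) ⟩
      M * D x y - hit y x + (hit y x - D y x * D y x)
        ≡⟨ cong (_+ (hit y x - D y x * D y x)) (hit-via-commute x y) ⟨
      hit x y + (hit y x - D y x * D y x) ∎)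
      where
      M : ℚ
      M = fromℕ (2 ℕ.* edges G)

    onPath-sym : ∀ {w x y} → OnPath G w x y → OnPath G w y x
    onPath-sym {w} {x} {y} p = dist⇒onPath (begin
      dist y w ℕ.+ dist w x    ≡⟨ ℕₚ.+-comm (dist y w) (dist w x) ⟩
      dist w x ℕ.+ dist y w    ≡⟨ cong₂ ℕ._+_ (dist-sym w x) (dist-sym y w) ⟩
      dist x w ℕ.+ dist w y    ≡⟨ onPath⇒dist p ⟩
      dist x y                 ≡⟨ dist-sym x y ⟩
      dist y x                 ∎)

    hit≡upper⇔extremal : ∀ x y → (hit x y ≡ fromℕ (2 ℕ.* edges G) * D x y - D x y * D x y)
                               ⇔ (∀ w → OnPath G w x y ⊎ OnPath G x w y)
    hit≡upper⇔extremal x y = mk⇔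
      (λ eq w → Sum.map₁ onPath-sym (Equivalence.to (hit≡D²⇔extremal y x) (flip eq) w))
      (λ ext → unflip (Equivalence.from (hit≡D²⇔extremal y x) (Sum.map₁ onPath-sym ∘ ext)))
      where
      p : ℚ
      p = fromℕ (2 ℕ.* edges G) * D x y
      flip : hit x y ≡ p - D x y * D x y → hit y x ≡ D y x * D y x
      flip eq = begin
        hit y x                      ≡⟨ solve 2 (λ p h → h := p :- (p :- h)) refl p (hit y x) ⟩
        p - (p - hit y x)            ≡⟨ cong (λ t → p - t) (trans (≡-sym (hit-via-commute x y)) eq) ⟩
        p - (p - D x y * D x y)      ≡⟨ solve 2 (λ p h → p :- (p :- h) := h) refl p (D x y * D x y) ⟩
        D x y * D x y                ≡⟨ cong (λ t → t * t) (D-sym x y) ⟩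
        D y x * D y x                ∎
      unflip : hit y x ≡ D y x * D y x → hit x y ≡ p - D x y * D x y
      unflip eq = trans (hit-via-commute x y) (cong (λ t → p - t) (trans eq (cong (λ t → t * t) (D-sym y x))))

    -- Convergence of the hitting-time series

    module _ (y : Fin n) where
      open Killed y

      -- The default value 0 of `invDeg` is thereby excluded off `y`, and the row of `y` in `Q` is
      -- zero in any case, so `invDeg` acts as a true inverse wherever `Q` uses it.
      degree≢0 : ∀ {x} → x ≢ y → deg G x ≢ 0
      degree≢0 {x} x≢y eq with closer-neighbour x≢y
      ... | u , e , _ = 1≰0 (subst₂ _≤_ (A-adj e) (trans (≡-sym (fromℕ-deg x)) (trans (cong fromℕ eq) fromℕ-0)) (term≤sum (A x) (0≤A x) u))
        where
        1≰0 : ¬ 1ℚ ≤ 0ℚ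
        1≰0 le with fromℕ-cancel-≤ (subst₂ _≤_ (≡-sym fromℕ-1) (≡-sym fromℕ-0) le)
        ... | ()

      h : Fin n → ℚ
      h x = hit x y

      Q-at-target : ∀ f → Q f y ≡ 0ℚ
      Q-at-target f = trans (cong (λ d → (1ℚ - d) * c) (δ-refl y)) (*-zeroˡ c)
        where
        c : ℚ
        c = invDeg G y * sum (λ u → A y u * f u)

      Q-elsewhere : ∀ f {x} → x ≢ y → Q f x ≡ invDeg G x * sum (λ u → A x u * f u)
      Q-elsewhere f {x} x≢y = trans (cong (λ d → (1ℚ - d) * c) (δ-≢ x≢y)) (*-identityˡ c)
        where
        c : ℚ
        c = invDeg G x * sum (λ u → A x u * f u)

      split : ∀ {f g : Fin n → ℚ} → f y ≡ g y → (∀ x → x ≢ y → f x ≡ g x) → ∀ x → f x ≡ g x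
      split at off x with x ≟ y
      ... | yes refl = at
      ... | no x≢y   = off x x≢y

      Q-1 : ∀ x → Q (λ _ → 1ℚ) x ≡ 1ℚ - δ x y
      Q-1 = split (trans (Q-at-target (λ _ → 1ℚ)) (≡-sym (cong (λ d → 1ℚ - d) (δ-refl y)))) λ x x≢y → begin
        Q (λ _ → 1ℚ) x                            ≡⟨ Q-elsewhere (λ _ → 1ℚ) x≢y ⟩
        invDeg G x * sum (λ u → A x u * 1ℚ)     ≡⟨ cong (invDeg G x *_) (sum-cong-≗ λ u → ℚₚ.*-identityʳ (A x u)) ⟩
        invDeg G x * degree x                   ≡⟨ invDeg-inverse x (degree≢0 x≢y) ⟩
        1ℚ - 0ℚ                                   ≡⟨ cong (λ d → 1ℚ - d) (δ-≢ x≢y) ⟨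
        1ℚ - δ x y                                ∎

      -- Off `y` this is `lap-hit` divided by the degree, the first-step equation h = 1 + average of
      -- h over the neighbours. At `y` both sides are 0.
      Q-h : ∀ x → Q h x ≡ h x - (1ℚ - δ x y)
      Q-h = split
        (trans (Q-at-target h) (≡-sym (cong₂ (λ s d → s - (1ℚ - d)) (hit-target y) (δ-refl y))))
        λ x x≢y → let i = invDeg G x
                      S = sum (λ u → A x u * h u)
                      inv = invDeg-inverse x (degree≢0 x≢y) in begin
          Q h x
            ≡⟨ Q-elsewhere h x≢y ⟩
          i * S
            ≡⟨ solve 4 (λ i s g h → i :* s := i :* g :* h :- i :* (g :* h :- s)) refl i S (degree x) (h x) ⟩
          i * degree x * h x - i * (degree x * h x - S)
            ≡⟨ cong (λ t → i * degree x * h x - i * t) (≡-sym (lap-expand x)) ⟩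
          i * degree x * h x - i * lap h x
            ≡⟨ cong₂ (λ s t → s * h x - i * t) inv (lap-hit x≢y) ⟩
          1ℚ * h x - i * degree x
            ≡⟨ cong₂ _-_ (*-identityˡ (h x)) inv ⟩
          h x - (1ℚ - 0ℚ)
            ≡⟨ cong (λ d → h x - (1ℚ - d)) (δ-≢ x≢y) ⟨
          h x - (1ℚ - δ x y) ∎
        where
        lap-expand : ∀ x → lap h x ≡ degree x * h x - sum (λ u → A x u * h u)
        lap-expand x = begin
          sum (λ u → A x u * (h x - h u))
            ≡⟨ sum-cong-≗ (λ u → solve 3 (λ a p q → a :* (p :- q) := a :* p :- a :* q) refl (A x u) (h x) (h u)) ⟩
          sum (λ u → A x u * h x - A x u * h u)
            ≡⟨ sum-- (λ u → A x u * h x) (λ u → A x u * h u) ⟩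
          sum (λ u → A x u * h x) - sum (λ u → A x u * h u)
            ≡⟨ cong (λ s → s - sum (λ u → A x u * h u)) (*-distribʳ-sum (h x) (A x)) ⟨
          degree x * h x - sum (λ u → A x u * h u) ∎

      -- Once h is known to be the expectation of τ, this is the part of that expectation carried by
      -- τ ≥ `K`.
      deficit : ℕ → Fin n → ℚ
      deficit K x = h x - sumBelow G (λ k → kp k x) K

      survival-suc : ∀ K x → survival (suc K) x ≡ Q (survival K) x
      survival-suc K x = begin
        1ℚ - sumBelow G (λ k → p k x) (suc K)
          ≡⟨ cong (λ s → 1ℚ - s) (sumBelow-suc (λ k → p k x) K) ⟩
        1ℚ - (p 0 x + sumBelow G (λ k → p (suc k) x) K)
          ≡⟨ cong₂ (λ s t → 1ℚ - (s + t)) (probHitAt-zero x) (trans (sumBelow-cong (λ k → probHitAt-suc k x) K) (sumBelow-Q p K x)) ⟩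
        1ℚ - (δ x y + Q (λ u → sumBelow G (λ k → p k u) K) x)
          ≡⟨ solve 2 (λ d q → con 1ℚ :- (d :+ q)
              := con 1ℚ :- d :- q) refl (δ x y) (Q (λ u → sumBelow G (λ k → p k u) K) x) ⟩
        1ℚ - δ x y - Q (λ u → sumBelow G (λ k → p k u) K) x
          ≡⟨ cong (_- Q (λ u → sumBelow G (λ k → p k u) K) x) (Q-1 x) ⟨
        Q (λ _ → 1ℚ) x - Q (λ u → sumBelow G (λ k → p k u) K) x
          ≡⟨ Q-- (λ _ → 1ℚ) (λ u → sumBelow G (λ k → p k u) K) x ⟨
        Q (survival K) x ∎

      sumBelow-+ : ∀ (f g : ℕ → ℚ) K → sumBelow G (λ k → f k + g k) K ≡ sumBelow G f K + sumBelow G g K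
      sumBelow-+ f g zero    = refl
      sumBelow-+ f g (suc K) = trans (cong (_+ (f K + g K)) (sumBelow-+ f g K))
        (solve 4 (λ a b c d → a :+ b :+ (c :+ d)
            := a :+ c :+ (b :+ d)) refl (sumBelow G f K) (sumBelow G g K) (f K) (g K))

      -- After one step τ has decreased by 1, so the tail expectation at `suc K` is carried back to
      -- that at `K` plus one unit for each surviving trajectory. In the series this is (k+1) p(k+1)
      -- = Q (k p(k) + p(k)).
      deficit-suc : ∀ K x → deficit (suc K) x ≡ Q (λ u → deficit K u + survival K u) x
      deficit-suc K x = ≡-sym (begin
        Q (λ u → deficit K u + survival K u) x
          ≡⟨ Q-+ (deficit K) (survival K) x ⟩
        Q (deficit K) x + Q (survival K) x
          ≡⟨ cong₂ _+_ (Q-- h S x) (Q-- (λ _ → 1ℚ) R x) ⟩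
        (Q h x - Q S x) + (Q (λ _ → 1ℚ) x - Q R x)
          ≡⟨ cong₂ (λ s t → (s - Q S x) + (t - Q R x)) (Q-h x) (Q-1 x) ⟩
        (h x - (1ℚ - δ x y) - Q S x) + (1ℚ - δ x y - Q R x)
          ≡⟨ solve 4 (λ h c s r → (h :- c :- s) :+ (c :- r)
              := h :- (con 0ℚ :+ (s :+ r))) refl (h x) (1ℚ - δ x y) (Q S x) (Q R x) ⟩
        h x - (0ℚ + (Q S x + Q R x))
          ≡⟨ cong₂ (λ s t → h x - (s + t)) (≡-sym first) (≡-sym rest) ⟩
        h x - (kp 0 x + sumBelow G (λ k → kp (suc k) x) K)
          ≡⟨ cong (λ s → h x - s) (sumBelow-suc (λ k → kp k x) K) ⟨
        deficit (suc K) x ∎)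
        where
        S R : Fin n → ℚ
        S u = sumBelow G (λ k → kp k u) K
        R u = sumBelow G (λ k → p k u) K
        first : kp 0 x ≡ 0ℚ
        first = *-zeroˡ (p 0 x)
        shift : ∀ k → kp (suc k) x ≡ Q (λ u → kp k u + p k u) x
        shift k = begin
          ℕ→ℚ (suc k) * p (suc k) x
            ≡⟨ cong₂ _*_ (trans (≡-sym (fromℕ-def (suc k))) (trans (fromℕ-suc k) (cong (_+ 1ℚ) (fromℕ-def k)))) (probHitAt-suc k x) ⟩
          (ℕ→ℚ k + 1ℚ) * Q (p k) x
            ≡⟨ Q-scale (ℕ→ℚ k + 1ℚ) (p k) x ⟨
          Q (λ u → (ℕ→ℚ k + 1ℚ) * p k u) x
            ≡⟨ Q-cong (λ u → solve 2 (λ k q → (k :+ con 1ℚ) :* q := k :* q :+ q) refl (ℕ→ℚ k) (p k u)) x ⟩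
          Q (λ u → kp k u + p k u) x ∎
        rest : sumBelow G (λ k → kp (suc k) x) K ≡ Q S x + Q R x
        rest = begin
          sumBelow G (λ k → kp (suc k) x) K
            ≡⟨ sumBelow-cong shift K ⟩
          sumBelow G (λ k → Q (λ u → kp k u + p k u) x) K
            ≡⟨ sumBelow-Q (λ k u → kp k u + p k u) K x ⟩
          Q (λ u → sumBelow G (λ k → kp k u + p k u) K) x
            ≡⟨ Q-cong (λ u → sumBelow-+ (λ k → kp k u) (λ k → p k u) K) x ⟩
          Q (λ u → S u + R u) x
            ≡⟨ Q-+ S R x ⟩
          Q S x + Q R x ∎

      0≤h : ∀ x → 0ℚ ≤ h x
      0≤h x = ℚₚ.≤-trans (0≤* (0≤fromℕ _) (0≤fromℕ _)) (D²≤hit x y)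

      -- Since h = Q h + 1 off y, the killed walk contracts h by the factor 1 − 1/M whenever
      -- h ≤ M; with L = 2M and κ = 1/L this factor is 1 − 2κ, which leaves room for the
      -- cross term in the recursion for the deficit.
      M L : ℚ
      M = 1ℚ + sum h
      L = 2ℚ * M

      1≤M : 1ℚ ≤ M
      1≤M = ≤-witness (sum h) (sum-nonneg h 0≤h) refl

      1≤L : 1ℚ ≤ L
      1≤L = ℚₚ.≤-trans 1≤M (≤-witness M (ℚₚ.≤-trans 0≤1 1≤M) (solve 1 (λ m → con 2ℚ :* m := m :+ m) refl M))

      0≤L : 0ℚ ≤ L
      0≤L = ℚₚ.≤-trans 0≤1 1≤L

      instance
        L-positive : ℚ.Positive L
        L-positive = ℚ.positive (ℚₚ.<-≤-trans (ℚₚ.positive⁻¹ 1ℚ) 1≤L)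
        L-nonZero : ℚ.NonZero L
        L-nonZero = ℚₚ.pos⇒nonZero L

      abstract
        κ : ℚ
        κ = 1/ L

        κ*L : κ * L ≡ 1ℚ
        κ*L = ℚₚ.*-inverseˡ L

        0≤κ : 0ℚ ≤ κ
        0≤κ = ℚₚ.<⇒≤ (ℚₚ.positive⁻¹ (1/ L) {{ℚₚ.1/pos⇒pos L}})

      0≤1-κ : 0ℚ ≤ 1ℚ - κ
      0≤1-κ = ≤⇒0≤- (subst₂ _≤_ (ℚₚ.*-identityʳ κ) κ*L (*-monoˡ 0≤κ 1≤L))

      -- Here 2κ = 1/M, and `M` dominates each value of h as a summand of a nonnegative sum. At `y`
      -- both sides vanish. This is what makes the loss of 1 in `Q-h` proportional to h.
      2κh≤1-δ : ∀ x → 2ℚ * κ * h x ≤ 1ℚ - δ x y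
      2κh≤1-δ x with x ≟ y
      ... | yes refl = ℚₚ.≤-reflexive (trans (cong (2ℚ * κ *_) (hit-target x)) (*-zeroʳ (2ℚ * κ)))
      ... | no _ = ℚₚ.≤-trans (*-monoˡ (0≤* (0≤+ 0≤1 0≤1) 0≤κ) h≤M)
          (ℚₚ.≤-reflexive (trans (solve 2 (λ k m → con 2ℚ :* k :* m := k :* (con 2ℚ :* m)) refl κ M) κ*L))
        where
        h≤M : h x ≤ M
        h≤M = ℚₚ.≤-trans (term≤sum h 0≤h x) (≤-witness 1ℚ 0≤1 (ℚₚ.+-comm 1ℚ (sum h)))

      Q-h≤ : ∀ x → Q h x ≤ (1ℚ - 2ℚ * κ) * h x
      Q-h≤ x = ≤-witness (1ℚ - δ x y - 2ℚ * κ * h x) (≤⇒0≤- (2κh≤1-δ x))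
        (trans (solve 3 (λ k h c → (con 1ℚ :- con 2ℚ :* k) :* h
            := h :- c :+ (c :- con 2ℚ :* k :* h)) refl κ (h x) (1ℚ - δ x y))
          (cong (_+ (1ℚ - δ x y - 2ℚ * κ * h x)) (≡-sym (Q-h x))))

      β : ℕ → ℚ
      β zero    = 1ℚ
      β (suc K) = (1ℚ - κ) * β K

      0≤β : ∀ K → 0ℚ ≤ β K
      0≤β zero    = 0≤1
      0≤β (suc K) = 0≤* 0≤1-κ (0≤β K)

      -- Bernoulli's inequality (1 + K/L)(1 - 1/L)^K ≤ 1, cleared of denominators. The left side
      -- never increases: since κL = 1, the step to `suc K` loses exactly κ(K+1)β(K).
      bernoulli : ∀ K → (L + fromℕ K) * β K ≤ L
      bernoulli zero    = ℚₚ.≤-reflexive (trans (ℚₚ.*-identityʳ (L + fromℕ 0)) (trans (cong (L +_) fromℕ-0) (+-identityʳ L)))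
      bernoulli (suc K) = ℚₚ.≤-trans (≤-witness (κ * (fromℕ K + 1ℚ) * β K)
          (0≤* (0≤* 0≤κ (0≤+ (0≤fromℕ K) 0≤1)) (0≤β K))
          (begin
            (L + fromℕ K) * β K
              ≡⟨ solve 3 (λ l m b → (l :+ m) :* b := (l :+ (m :+ con 1ℚ)) :* b :- con 1ℚ :* b) refl L (fromℕ K) (β K) ⟩
            (L + (fromℕ K + 1ℚ)) * β K - 1ℚ * β K
              ≡⟨ cong (λ t → (L + (fromℕ K + 1ℚ)) * β K - t * β K) κ*L ⟨
            (L + (fromℕ K + 1ℚ)) * β K - κ * L * β K
              ≡⟨ solve 4 (λ l m b k → (l :+ m) :* b :- k :* l :* b
                  := (l :+ m) :* ((con 1ℚ :- k) :* b) :+ k :* m :* b) refl L (fromℕ K + 1ℚ) (β K) κ ⟩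
            (L + (fromℕ K + 1ℚ)) * ((1ℚ - κ) * β K) + κ * (fromℕ K + 1ℚ) * β K
              ≡⟨ cong (λ t → (L + t) * ((1ℚ - κ) * β K) + κ * (fromℕ K + 1ℚ) * β K) (fromℕ-suc K) ⟨
            (L + fromℕ (suc K)) * ((1ℚ - κ) * β K) + κ * (fromℕ K + 1ℚ) * β K ∎))
        (bernoulli K)

      suc*β≤L : ∀ K → fromℕ (suc K) * β K ≤ L
      suc*β≤L K = ℚₚ.≤-trans (≤-witness ((L - 1ℚ) * β K) (0≤* (≤⇒0≤- 1≤L) (0≤β K))
        (trans (solve 3 (λ l m b → (l :+ m) :* b := (m :+ con 1ℚ) :* b :+ (l :- con 1ℚ) :* b) refl L (fromℕ K) (β K))
          (cong (λ t → t * β K + (L - 1ℚ) * β K) (≡-sym (fromℕ-suc K)))))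
        (bernoulli K)

      0≤survival : ∀ K x → 0ℚ ≤ survival K x
      0≤survival zero    x = 0≤1
      0≤survival (suc K) x = subst (0ℚ ≤_) (≡-sym (survival-suc K x)) (Q-nonneg (0≤survival K) x)

      0≤deficit : ∀ K x → 0ℚ ≤ deficit K x
      0≤deficit zero    x = subst (0ℚ ≤_) (≡-sym (+-identityʳ (h x))) (0≤h x)
      0≤deficit (suc K) x = subst (0ℚ ≤_) (≡-sym (deficit-suc K x)) (Q-nonneg (λ u → 0≤+ (0≤deficit K u) (0≤survival K u)) x)

      Q-bound : ∀ {f c} → 0ℚ ≤ c → (∀ u → f u ≤ c * h u) → ∀ x → Q f x ≤ c * ((1ℚ - 2ℚ * κ) * h x)
      Q-bound {f} {c} 0≤c f≤ x = ℚₚ.≤-trans (Q-mono f≤ x)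
        (subst (_≤ c * ((1ℚ - 2ℚ * κ) * h x)) (≡-sym (Q-scale c h x)) (*-monoˡ 0≤c (Q-h≤ x)))

      -- The bound starts at index 1, because at `y` the value of `survival 0` is 1 while h is 0.
      -- There 1 - δ ≤ h follows from h = Q h + (1 - δ); afterwards `Q` contracts by 1 - 2κ,
      -- stronger than the 1 - κ claimed.
      survival≤ : ∀ K x → survival (suc K) x ≤ β K * h x
      survival≤ zero x = subst (_≤ 1ℚ * h x) (≡-sym (survival-suc 0 x))
        (≤-witness (Q h x) (Q-nonneg 0≤h x)
          (trans (solve 2 (λ h c → con 1ℚ :* h := c :+ (h :- c)) refl (h x) (1ℚ - δ x y))
            (≡-sym (cong₂ _+_ (Q-1 x) (Q-h x)))))
      survival≤ (suc K) x = subst (_≤ β (suc K) * h x) (≡-sym (survival-suc (suc K) x))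
        (ℚₚ.≤-trans (Q-bound (0≤β K) (survival≤ K) x)
          (≤-witness (κ * (β K * h x)) (0≤* 0≤κ (0≤* (0≤β K) (0≤h x)))
            (solve 3 (λ k b h → (con 1ℚ :- k) :* b :* h
                := b :* ((con 1ℚ :- con 2ℚ :* k) :* h) :+ k :* (b :* h)) refl κ (β K) (h x))))

      -- The prefactor `L` absorbs the survival term: with κL = 1, (L + 1)(1 - 2κ) = L - 1 - 2κ,
      -- whereas L(1 - κ) = L - 1. The difference 2κ is the witness of the inductive step.
      deficit≤ : ∀ K x → deficit (suc K) x ≤ L * β K * h x
      deficit≤ zero x = subst (_≤ L * 1ℚ * h x) (≡-sym base)
        (≤-witness ((L - 1ℚ) * h x) (0≤* (≤⇒0≤- 1≤L) (0≤h x))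
          (solve 2 (λ l h → l :* con 1ℚ :* h := h :+ (l :- con 1ℚ) :* h) refl L (h x)))
        where
        base : deficit 1 x ≡ h x
        base = begin
          deficit 1 x                              ≡⟨ deficit-suc 0 x ⟩
          Q (λ u → deficit 0 u + survival 0 u) x   ≡⟨ Q-cong (λ u → cong (_+ 1ℚ) (+-identityʳ (h u))) x ⟩
          Q (λ u → h u + 1ℚ) x              ≡⟨ Q-+ h (λ _ → 1ℚ) x ⟩
          Q h x + Q (λ _ → 1ℚ) x            ≡⟨ cong₂ _+_ (Q-h x) (Q-1 x) ⟩
          h x - (1ℚ - δ x y) + (1ℚ - δ x y) ≡⟨ solve 2 (λ h c → h :- c :+ c := h) refl (h x) (1ℚ - δ x y) ⟩
          h x                               ∎
      deficit≤ (suc K) x = subst (_≤ L * β (suc K) * h x) (≡-sym (deficit-suc (suc K) x))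
        (ℚₚ.≤-trans (Q-bound (0≤+ (0≤* 0≤L (0≤β K)) (0≤β K)) together x)
          (≤-witness (2ℚ * κ * (β K * h x)) (0≤* (0≤* (0≤+ 0≤1 0≤1) 0≤κ) (0≤* (0≤β K) (0≤h x))) (begin
            L * ((1ℚ - κ) * β K) * h x
              ≡⟨ solve 4 (λ l k b h → l :* ((con 1ℚ :- k) :* b) :* h
                  := (l :* b :+ b) :* ((con 1ℚ :- con 2ℚ :* k) :* h) :+ con 2ℚ :* k :* (b :* h) :+ (k :* l :- con 1ℚ) :* (b :* h))
                  refl L κ (β K) (h x) ⟩
            (L * β K + β K) * ((1ℚ - 2ℚ * κ) * h x) + 2ℚ * κ * (β K * h x) + (κ * L - 1ℚ) * (β K * h x)
              ≡⟨ cong (λ t → (L * β K + β K) * ((1ℚ - 2ℚ * κ) * h x) + 2ℚ * κ * (β K * h x) + (t - 1ℚ) * (β K * h x)) κ*L ⟩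
            (L * β K + β K) * ((1ℚ - 2ℚ * κ) * h x) + 2ℚ * κ * (β K * h x) + (1ℚ - 1ℚ) * (β K * h x)
              ≡⟨ solve 2 (λ q r → q :+ (con 1ℚ :- con 1ℚ) :* r
                  := q) refl ((L * β K + β K) * ((1ℚ - 2ℚ * κ) * h x) + 2ℚ * κ * (β K * h x)) (β K * h x) ⟩
            (L * β K + β K) * ((1ℚ - 2ℚ * κ) * h x) + 2ℚ * κ * (β K * h x) ∎)))
        where
        together : ∀ u → deficit (suc K) u + survival (suc K) u ≤ (L * β K + β K) * h u
        together u = subst (deficit (suc K) u + survival (suc K) u ≤_) (≡-sym (ℚₚ.*-distribʳ-+ (h u) (L * β K) (β K)))
          (ℚₚ.+-mono-≤ (deficit≤ K u) (survival≤ K u))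

      hittingTime : ∀ x → IsHittingTime G x y (hit x y)
      hittingTime x =
        converges G (λ K → survival K x) 1ℚ (L * h x)
          (λ K → solve 1 (λ s → s := con 1ℚ :- (con 1ℚ :- s)) refl (sumBelow G (λ k → p k x) K))
          (λ K → 0≤survival K x)
          (λ K → decay K (0≤h x) (survival≤ K x)) ,
        converges G (λ K → deficit K x) (h x) (L * (L * h x))
          (λ K → solve 2 (λ s h → s := h :- (h :- s)) refl (sumBelow G (λ k → kp k x) K) (h x))
          (λ K → 0≤deficit K x)
          (λ K → decay K (0≤* 0≤L (0≤h x)) (subst (deficit (suc K) x ≤_)
            (solve 3 (λ l b h → l :* b :* h := b :* (l :* h)) refl L (β K) (h x)) (deficit≤ K x)))
        where
        decay : ∀ K {q r} → 0ℚ ≤ r → q ≤ β K * r → fromℕ (suc K) * q ≤ L * r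
        decay K {q} {r} 0≤r q≤ = ℚₚ.≤-trans (*-monoˡ (0≤fromℕ (suc K)) q≤)
          (subst₂ _≤_ (solve 3 (λ r k b → r :* (k :* b) := k :* (b :* r)) refl r (fromℕ (suc K)) (β K)) (ℚₚ.*-comm r L)
            (*-monoˡ 0≤r (suc*β≤L K)))

-- The two bounds with their equality cases, for the distance given by shortest walks

open import Data.Nat using (_*_; _∸_)
open import Data.Rational using (_≤_)

theorem11 : ∀ {n} (T : Graph n) → IsTree T → (x y : Fin n) (d : ℕ) → IsDist T x y d →
    Σ ℚ λ h → IsHittingTime T x y h
    × (ℕ→ℚ (d * d) ≤ h)
    × (h ≤ ℕ→ℚ (d * (2 * edges T ∸ d)))
    × ((h ≡ ℕ→ℚ (d * d)) ⇔ (∀ w → OnPath T w x y ⊎ OnPath T y w x))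
    × ((h ≡ ℕ→ℚ (d * (2 * edges T ∸ d))) ⇔ (∀ w → OnPath T w x y ⊎ OnPath T x w y))
theorem11 T tree x y d isDist with TreeDistance.Tree.dist-unique T tree isDist
... | refl =
  hit x y ,
  hittingTime y x ,
  subst (_≤ hit x y) (lower-value x y) (D²≤hit x y) ,
  subst (hit x y ≤_) (upper-value x y) (hit≤ x y) ,
  subst (λ t → (hit x y ≡ t) ⇔ Extremal x y) (lower-value x y) (hit≡D²⇔extremal x y) ,
  subst (λ t → (hit x y ≡ t) ⇔ (∀ w → OnPath T w x y ⊎ OnPath T x w y)) (upper-value x y) (hit≡upper⇔extremal x y)
  where open RandomWalk.OnTree T tree
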